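{- Let $H$ be a split-prime graph. Suppose that every induced subgraph of $H$ is path-extremal. Then every graph in $\mathcal{C}(H)$ is path-extremal, where $\mathcal{C}(H)$ is the class of connected graphs whose canonical split decomposition has exactly one prime bag and whose unique prime bag has label graph isomorphic to $H$.
   Context: All graphs are finite, simple and undirected; $P_n$ is the path on $n$ vertices. Zero forcing: given $S\subseteq V(G)$, color $S$ blue and the other vertices white. If a blue vertex has exactly one white neighbor, it forces that neighbor to become blue. Apply this rule repeatedly until no further force is possible. $S$ is a zero forcing set if all vertices end up blue. $z(G;k)$ is the number of zero forcing sets of $G$ of size $k$. A graph $G$ on $n$ vertices is path-extremal if $z(G;k)\le z(P_n;k)$ for all $0\le k\le n$. A split of a connected graph $G$ is a partition $(A,B)$ of $V(G)$ with $|A|,|B|\ge 2$ for which there are nonempty $A_1\subseteq A$, $B_1\subseteq B$ such that for all $a\in A$, $b\in B$: $ab\in E(G)$ iff $a\in A_1$ and $b\in B_1$. A connected graph is split-prime if it has no split and is neither a clique nor a star. Graph-labelled trees: a graph-labelled-tree representation of a connected graph $G$ is a tree $T$ whose nodes, called bags, each carry a connected label graph. Each tree edge $BB'$ corresponds to one vertex of the label of $B$ and one vertex of the label of $B'$, called marker vertices; different tree edges at a bag correspond to different markers. All non-marker vertices of the labels are ordinary vertices, and the ordinary vertices (over all bags) are exactly the vertices of $G$. Adjacency in $G$ is given by accessibility: two ordinary vertices in the same bag are adjacent in $G$ iff they are adjacent in its label; ordinary vertices $u,v$ in distinct bags $B_0,B_t$, joined by the tree path $B_0,B_1,\dots,B_t$,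 are adjacent in $G$ iff $u$ is adjacent in $B_0$ to the marker for $B_0B_1$, for each $1\le i\le t-1$ the markers of $B_i$ for $B_{i-1}B_i$ and $B_iB_{i+1}$ are adjacent in $B_i$, and the marker of $B_t$ for $B_{t-1}B_t$ is adjacent to $v$ in $B_t$. The representation is reduced (standard sense of split decomposition) if each label is a clique with at least three vertices (clique bag), a star with at least three vertices (star bag), or a split-prime graph (prime bag); no tree edge joins two clique bags; and no tree edge joins two star bags such that its marker is a leaf of one star and the center of the other. The canonical split decomposition of $G$ is its (unique up to isomorphism) reduced graph-labelled-tree representation. -}

module Defs where

open import Data.Bool using (Bool; T; _∨_; T?)
open import Data.Bool.Properties using (T-∨)
open import Data.Fin using (Fin; toℕ; _≟_)
open import Data.Fin.Properties using (any?; all?)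
open import Data.Fin.Subset
  using (Subset; inside; outside; _∈_; _∉_; _⊆_; _⊃_; _∪_; ⁅_⁆; ∁; ∣_∣; Nonempty) renaming (⊤ to full)
open import Data.Fin.Subset.Induction using (⊃-wellFounded)
open import Data.Fin.Subset.Properties
  using (_∈?_; p⊆p∪q; q⊆p∪q; x∈⁅x⁆; x∈⁅y⁆⇒x≡y; x∈p∪q⁻; ∈⊤; ⊆⊤; ⊆-antisym)
open import Data.List using (List; []; _∷_; _++_; map; filter; length)
open import Data.List.Relation.Unary.Unique.Propositional using (Unique)
open import Data.Nat using (ℕ; zero; suc; _≤_; _<_; _≡ᵇ_)
import Data.Nat as ℕ
open import Data.Nat.Properties using (1+n≢n; ≡ᵇ⇒≡)
open import Data.Product using (Σ; ∃; ∃-syntax; _×_; _,_; proj₁; proj₂)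
open import Data.Sum using (_⊎_; inj₁; inj₂; swap; [_,_]′)
open import Data.Vec using ([]; _∷_)
open import Function using (_⇔_; _↔_; module Equivalence; module Inverse)
open import Induction.WellFounded using (Acc; acc)
open import Level using (0ℓ)
open import Relation.Binary using (Rel; Symmetric)
open import Relation.Binary.Construct.Closure.ReflexiveTransitive using (Star; ε; _◅_)
open import Relation.Binary.PropositionalEquality using (_≡_; _≢_; refl; sym; subst)
open import Relation.Nullary using (¬_; Dec; yes; no; contradiction)
open import Relation.Nullary.Decidable using (_×-dec_; _→-dec_; ¬?; map′)
open import Function.Definitions using (Injective)

private
  variable
    m n : ℕ

record Graph (n : ℕ) : Set where
  field
    adj : Fin n → Fin n → Bool

  infix 4 _~_

  _~_ : Fin n → Fin n → Set
  u ~ v = T (adj u v)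

  field
    ~-sym    : Symmetric _~_
    ~-irrefl : ∀ {v} → ¬ v ~ v

open Graph using (adj; ~-sym; ~-irrefl)

infix 4 _⊢_~_

_⊢_~_ : Graph n → Fin n → Fin n → Set
G ⊢ u ~ v = Graph._~_ G u v

path : ∀ n → Graph n
path n = record
  { adj      = λ u v → (suc (toℕ u) ≡ᵇ toℕ v) ∨ (suc (toℕ v) ≡ᵇ toℕ u)
  ; ~-sym    = λ {u} {v} → symmetric u v
  ; ~-irrefl = λ {v} e → [ loop v , loop v ]′ (Equivalence.to (T-∨ {suc (toℕ v) ≡ᵇ toℕ v}) e)
  }
  where
  symmetric : ∀ (u v : Fin n) →
              T ((suc (toℕ u) ≡ᵇ toℕ v) ∨ (suc (toℕ v) ≡ᵇ toℕ u)) →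
              T ((suc (toℕ v) ≡ᵇ toℕ u) ∨ (suc (toℕ u) ≡ᵇ toℕ v))
  symmetric u v e = Equivalence.from (T-∨ {suc (toℕ v) ≡ᵇ toℕ u})
    (swap (Equivalence.to (T-∨ {suc (toℕ u) ≡ᵇ toℕ v}) e))

  loop : ∀ (v : Fin n) → ¬ T (suc (toℕ v) ≡ᵇ toℕ v)
  loop v t = 1+n≢n (≡ᵇ⇒≡ (suc (toℕ v)) (toℕ v) t)

IsInducedSubgraph : Graph m → Graph n → Set
IsInducedSubgraph {m} {n} K H =
  Σ (Fin m → Fin n) λ f →
    Injective _≡_ _≡_ f × (∀ u v → adj K u v ≡ adj H (f u) (f v))

infix 4 _≅_

_≅_ : Graph m → Graph n → Set
_≅_ {m} {n} G H =
  Σ (Fin m ↔ Fin n) λ φ →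
    ∀ u v → adj G u v ≡ adj H (Inverse.to φ u) (Inverse.to φ v)

Walk : Graph n → Fin n → Fin n → Set
Walk G = Star (G ⊢_~_)

vertices : ∀ {R : Rel (Fin n) 0ℓ} {u v} → Star R u v → List (Fin n)
vertices {u = u} ε       = u ∷ []
vertices {u = u} (_ ◅ w) = u ∷ vertices w

IsPath : ∀ {R : Rel (Fin n) 0ℓ} {u v} → Star R u v → Set
IsPath w = Unique (vertices w)

Connected : Graph n → Set
Connected {n} G = 0 < n × (∀ u v → Walk G u v)

-- A cycle is a path on at least three vertices whose ends are adjacent.
Acyclic : Graph n → Set
Acyclic G = ∀ {u v} (w : Walk G u v) → IsPath w → 3 ≤ length (vertices w) → ¬ G ⊢ v ~ u

IsTree : Graph n → Set
IsTree G = Connected G × Acyclic G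

-- Subsets record the blue vertices.
data Force (G : Graph n) (S : Subset n) : Subset n → Set where
  force : ∀ {u v} → u ∈ S → v ∉ S → G ⊢ u ~ v →
          (∀ w → G ⊢ u ~ w → w ∉ S → w ≡ v) →
          Force G S (S ∪ ⁅ v ⁆)

-- No force is possible once every vertex is blue.  Conversely, any
-- two maximal sequences of forces from S end in the same set, so it does not
-- matter which sequence is chosen.
ZeroForcing : Graph n → Subset n → Set
ZeroForcing G S = Star (Force G) S full

private
  CanForce : Graph n → Subset n → Set
  CanForce G S = ∃[ u ] ∃[ v ] (u ∈ S × v ∉ S × G ⊢ u ~ v ×
                                (∀ w → G ⊢ u ~ w → w ∉ S → w ≡ v))

  canForce? : ∀ (G : Graph n) S → Dec (CanForce G S)
  canForce? G S = any? λ u → any? λ v →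
    u ∈? S ×-dec ¬? (v ∈? S) ×-dec T? (adj G u v) ×-dec
    all? (λ w → T? (adj G u w) →-dec (¬? (w ∈? S) →-dec (w ≟ v)))

  force-⊆ : ∀ (G : Graph n) {S S′ R} → ¬ CanForce G R → S ⊆ R → Force G S S′ → S′ ⊆ R
  force-⊆ G {S} {R = R} stuck S⊆R (force {u} {v} u∈S _ u~v only) x∈ with x∈p∪q⁻ S ⁅ v ⁆ x∈
  ... | inj₁ x∈S = S⊆R x∈S
  ... | inj₂ x∈v with v ∈? R
  ...   | yes v∈R = subst (_∈ R) (sym (x∈⁅y⁆⇒x≡y v x∈v)) v∈R
  ...   | no  v∉R = contradiction
    (u , v , S⊆R u∈S , v∉R , u~v , λ w u~w w∉R → only w u~w (λ w∈S → w∉R (S⊆R w∈S))) stuck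

  forces-⊆ : ∀ (G : Graph n) {S S′ R} → ¬ CanForce G R → S ⊆ R → Star (Force G) S S′ → S′ ⊆ R
  forces-⊆ G stuck S⊆R ε        = S⊆R
  forces-⊆ G stuck S⊆R (f ◅ fs) = forces-⊆ G stuck (force-⊆ G stuck S⊆R f) fs

  run : ∀ (G : Graph n) S → Acc _⊃_ S →
        ∃[ R ] (Star (Force G) S R × ¬ CanForce G R)
  run G S (acc rec) with canForce? G S
  ... | no stuck = S , ε , stuck
  ... | yes (u , v , u∈S , v∉S , u~v , only)
    with run G (S ∪ ⁅ v ⁆) (rec (p⊆p∪q ⁅ v ⁆ , v , q⊆p∪q S ⁅ v ⁆ (x∈⁅x⁆ v) , v∉S))
  ...   | R , fs , stuck = R , force u∈S v∉S u~v only ◅ fs , stuck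

  allIn? : ∀ (S : Subset n) → Dec (full ⊆ S)
  allIn? S = map′ (λ h {x} _ → h x) (λ h x → h ∈⊤) (all? (_∈? S))

zeroForcing? : ∀ (G : Graph n) S → Dec (ZeroForcing G S)
zeroForcing? G S with run G S (⊃-wellFounded S)
... | R , fs , stuck with allIn? R
...   | yes full⊆R = yes (subst (Star (Force G) S) (⊆-antisym ⊆⊤ full⊆R) fs)
...   | no  full⊈R = no λ fs′ →
  full⊈R (forces-⊆ G stuck (forces-mono fs) fs′)
  where
  forces-mono : ∀ {S R} → Star (Force G) S R → S ⊆ R
  forces-mono ε                             x∈S = x∈S
  forces-mono (force {v = v} _ _ _ _ ◅ fs)  x∈S = forces-mono fs (p⊆p∪q ⁅ v ⁆ x∈S)

subsets : ∀ n → List (Subset n)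
subsets zero    = [] ∷ []
subsets (suc n) = map (inside ∷_) (subsets n) ++ map (outside ∷_) (subsets n)

z : Graph n → ℕ → ℕ
z {n} G k = length (filter (λ S → zeroForcing? G S ×-dec (∣ S ∣ ℕ.≟ k)) (subsets n))

PathExtremal : Graph n → Set
PathExtremal {n} G = ∀ k → k ≤ n → z G k ≤ z (path n) k

-- The two sides of the partition are A and its complement.
record Split (G : Graph n) : Set where
  field
    A A₁ B₁ : Subset n

  B : Subset n
  B = ∁ A

  field
    ∣A∣≥2       : 2 ≤ ∣ A ∣
    ∣B∣≥2       : 2 ≤ ∣ B ∣
    A₁⊆A        : A₁ ⊆ A
    B₁⊆B        : B₁ ⊆ B
    A₁-nonempty : Nonempty A₁
    B₁-nonempty : Nonempty B₁
    complete    : ∀ a b → a ∈ A → b ∈ B → (G ⊢ a ~ b) ⇔ (a ∈ A₁ × b ∈ B₁)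

IsClique : Graph n → Set
IsClique G = ∀ u v → u ≢ v → G ⊢ u ~ v

IsStarWithCentre : Graph n → Fin n → Set
IsStarWithCentre G c = ∀ u v → (G ⊢ u ~ v) ⇔ (u ≢ v × (u ≡ c ⊎ v ≡ c))

IsStar : Graph n → Set
IsStar G = ∃ (IsStarWithCentre G)

IsStarWithLeaf : Graph n → Fin n → Set
IsStarWithLeaf G x = ∃[ c ] (IsStarWithCentre G c × x ≢ c)

SplitPrime : Graph n → Set
SplitPrime G = Connected G × ¬ Split G × ¬ IsClique G × ¬ IsStar G

record GraphLabelledTree : Set where
  field
    #bags           : ℕ
    tree            : Graph #bags
    tree-isTree     : IsTree tree
    size            : Fin #bags → ℕ
    label           : ∀ i → Graph (size i)
    label-connected : ∀ i → Connected (label i)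
    -- For an edge e from i to j, marker e is its marker in bag i; the
    -- marker in bag j is that of the reversed edge.
    marker          : ∀ {i j} → tree ⊢ i ~ j → Fin (size i)
    marker-distinct : ∀ {i j k} (e : tree ⊢ i ~ j) (f : tree ⊢ i ~ k) →
                      marker {i} {j} e ≡ marker {i} {k} f → j ≡ k

  LabelVertex : Set
  LabelVertex = ∃[ i ] Fin (size i)

  IsMarker : LabelVertex → Set
  IsMarker (i , x) = ∃[ j ] Σ (tree ⊢ i ~ j) λ e → marker {i} {j} e ≡ x

  -- x is the end vertex in the first bag of the walk; in each recursive call
  -- it is the marker through which the walk has entered the current bag.
  AccessibleAlong : ∀ {i j} → Walk tree i j → Fin (size i) → Fin (size j) → Set
  AccessibleAlong {i} ε                 x y = label i ⊢ x ~ y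
  AccessibleAlong {i} (_◅_ {j = j} e w) x y =
    (label i ⊢ x ~ marker {i} {j} e) × AccessibleAlong w (marker {j} {i} (~-sym tree e)) y

  CliqueBag StarBag PrimeBag : Fin #bags → Set
  CliqueBag i = 3 ≤ size i × IsClique (label i)
  StarBag   i = 3 ≤ size i × IsStar (label i)
  PrimeBag  i = SplitPrime (label i)

  record Reduced : Set where
    field
      bag-kind         : ∀ i → CliqueBag i ⊎ StarBag i ⊎ PrimeBag i
      no-clique-clique : ∀ {i j} → tree ⊢ i ~ j → ¬ (CliqueBag i × CliqueBag j)
      no-leaf-centre   : ∀ {i j} (e : tree ⊢ i ~ j) → StarBag i → StarBag j →
                         ¬ (IsStarWithLeaf (label i) (marker {i} {j} e) ×
                            IsStarWithCentre (label j) (marker {j} {i} (~-sym tree e)))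

record Represents (D : GraphLabelledTree) (G : Graph n) : Set where
  open GraphLabelledTree D
  field
    place           : Fin n → LabelVertex
    place-injective : Injective _≡_ _≡_ place
    place-ordinary  : ∀ x → (∃[ v ] place v ≡ x) ⇔ (¬ IsMarker x)
    -- The tree path between two given bags is unique; for two vertices in
    -- the same bag it is the empty walk.
    accessibility   : ∀ u v (w : Walk tree (proj₁ (place u)) (proj₁ (place v))) → IsPath w →
                      (G ⊢ u ~ v) ⇔ AccessibleAlong w (proj₂ (place u)) (proj₂ (place v))

-- The canonical split decomposition is unique up to isomorphism, so being
-- canonical for G amounts to being some reduced representation of G.
IsCanonicalSplitDecomposition : GraphLabelledTree → Graph n → Set
IsCanonicalSplitDecomposition D G = Represents D G × GraphLabelledTree.Reduced D

record 𝒞 (H : Graph m) (G : Graph n) : Set where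
  field
    connected     : Connected G
    decomposition : GraphLabelledTree
    canonical     : IsCanonicalSplitDecomposition decomposition G

  open GraphLabelledTree decomposition public

  field
    prime-bag        : Fin #bags
    prime-bag-prime  : PrimeBag prime-bag
    prime-bag-unique : ∀ i → PrimeBag i → i ≡ prime-bag
    prime-bag-≅      : label prime-bag ≅ H

{-# OPTIONS --safe #-}
-- A set fails to be zero forcing iff it misses a fort: a nonempty set F such
-- that no vertex outside F has exactly one neighbour in F.  As all k-sets are
-- counted, G is path-extremal iff it has at least as many failing k-sets as the
-- path; those of the path are the sets of inner vertices without two
-- consecutive ones.
--
-- If G has an isolated vertex or a pair of twins, then every set avoiding it
-- fails, and these are already enough.  If v is pendant at u,
-- then #failing(G, k) ≥ #failing(G - v, k) + #failing(G - v - u, k - 1), and for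
-- the path the corresponding recurrence is an equality.
--
-- So it suffices that an induced subgraph K of G has an isolated vertex, twins
-- or a pendant vertex, or embeds in the prime label.  If at most one vertex of K
-- lies behind each marker of the prime bag, then K embeds or has an isolated
-- vertex.  Otherwise take a bag, as far from the prime bag as possible, with
-- two vertices of K behind it: in this clique or star they are represented by
-- distinct vertices, which makes them twins or one of them pendant.
module Submission where

open import Defs
open import Data.Nat using (ℕ; zero; suc; _+_; _≤_; _<_; z≤n; s≤s; _≡ᵇ_)

open Graph using (adj; ~-sym; ~-irrefl)

open import Algebra.Properties.CommutativeSemigroup using (interchange)
open import Data.Bool using (Bool; true; false; T; _∧_; not; T?)
open import Data.Bool.Properties using (T-irrelevant; T-∨)
open import Data.Fin using (Fin; zero; suc; toℕ; fromℕ<; punchIn; punchOut; _≟_)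
open import Data.Fin.Properties
  using (any?; all?; toℕ<n; toℕ-fromℕ<; toℕ-injective; punchIn-injective; punchInᵢ≢i; punchIn-punchOut;
         injective⇒≤)
open import Data.Fin.Subset
  using (Subset; inside; outside; _∈_; _∉_; _⊃_; _∪_; ⁅_⁆; ∁; ∣_∣; Nonempty)
open import Data.Fin.Subset.Induction using (⊃-wellFounded)
open import Data.Fin.Subset.Properties
  using (_∈?_; p⊆p∪q; q⊆p∪q; x∈⁅x⁆; x∈⁅y⁆⇒x≡y; x∈p∪q⁻; ∈⊤; ⊆⊤; ⊆-antisym; ∣p∣≤n;
         x∉p⇒x∈∁p; x∈∁p⇒x∉p; x∉∁p⇒x∈p)
open import Data.List using (List; []; _∷_; map; filter; length)
import Data.List as List
open import Data.List.Membership.Propositional using () renaming (_∈_ to _∈ˡ_)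
open import Data.List.Membership.Propositional.Properties using (∈-lookup)
open import Data.List.Properties using (filter-++; length-++)
open import Data.List.Relation.Unary.All using ([]; _∷_)
import Data.List.Relation.Unary.All as All
open import Data.List.Relation.Unary.AllPairs using ([]; _∷_)
open import Data.List.Relation.Unary.Any using (here; there)
open import Data.List.Relation.Unary.Unique.Propositional using (Unique)
open import Data.Maybe using (Maybe; just; nothing)
open import Data.Maybe.Properties using (just-injective)
import Data.Nat as ℕ
open import Data.Nat.Induction using (<-rec)
open import Data.Nat.Properties hiding (_≟_)
open import Data.Product using (Σ; ∃; ∃-syntax; _×_; _,_; proj₁; proj₂)
open import Data.Sum using (_⊎_; inj₁; inj₂; [_,_]′; map₁)
open import Data.Unit using (⊤)
open import Data.Vec using ([]; _∷_; lookup; insertAt; there)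
open import Data.Vec.Properties using (insertAt-lookup; insertAt-punchIn; []=⇒lookup; lookup⇒[]=)
open import Function using (_∘_; _⇔_; mk⇔; module Equivalence; module Inverse; module Injection)
open import Function.Definitions using (Injective)
open import Function.Properties.Inverse using (↔⇒↣)
open import Induction.WellFounded using (Acc; acc)
open import Level using (0ℓ)
open import Relation.Binary.Construct.Closure.ReflexiveTransitive using (Star; ε; _◅_)
open import Relation.Binary.PropositionalEquality
  using (_≡_; _≢_; refl; sym; trans; cong; cong₂; subst)
open import Relation.Nullary using (¬_; Dec; yes; no; does; contradiction)
open import Relation.Nullary.Decidable using (_×-dec_; _→-dec_; ¬?; decidable-stable)
open import Relation.Unary using (Pred; Decidable)

private
  variable
    m n : ℕ

-- Forts and zero forcing

record Obstructs (G : Graph n) (S F : Subset n) : Set where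
  field
    nonempty : Nonempty F
    disjoint : ∀ {x} → x ∈ F → x ∉ S
    fort     : ∀ {u v} → u ∉ F → v ∈ F → G ⊢ u ~ v →
               ∃[ w ] (w ∈ F × G ⊢ u ~ w × w ≢ v)

open Obstructs

-- A forced vertex cannot lie in the fort: the forcing vertex is blue, hence outside `F`, and would
-- have a second white neighbour in `F`.
obstructs-force : ∀ {G : Graph n} {S S′ F} → Obstructs G S F → Force G S S′ → Obstructs G S′ F
obstructs-force {S = S} {F = F} o (force {u} {v} u∈S v∉S u~v only) = record
  { nonempty = nonempty o ; disjoint = disj ; fort = fort o }
  where
  v∉F : v ∉ F
  v∉F v∈F with fort o (λ u∈F → disjoint o u∈F u∈S) v∈F u~v
  ... | w , w∈F , u~w , w≢v = w≢v (only w u~w (disjoint o w∈F))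

  disj : ∀ {x} → x ∈ F → x ∉ S ∪ ⁅ v ⁆
  disj x∈F x∈ with x∈p∪q⁻ S ⁅ v ⁆ x∈
  ... | inj₁ x∈S = disjoint o x∈F x∈S
  ... | inj₂ x∈v = v∉F (subst (_∈ F) (x∈⁅y⁆⇒x≡y v x∈v) x∈F)

obstructs⇒¬zeroForcing : ∀ {G : Graph n} {S F} → Obstructs G S F → ¬ ZeroForcing G S
obstructs⇒¬zeroForcing o ε        = disjoint o (proj₂ (nonempty o)) ∈⊤
obstructs⇒¬zeroForcing o (f ◅ fs) = obstructs⇒¬zeroForcing (obstructs-force o f) fs

-- The vertices that stay white once no force is possible form a fort.
zeroForcing-or-obstructed : ∀ (G : Graph n) S → Acc _⊃_ S → ZeroForcing G S ⊎ ∃ (Obstructs G S)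
zeroForcing-or-obstructed {n} G S (acc rec)
  with any? (λ u → any? λ v → u ∈? S ×-dec ¬? (v ∈? S) ×-dec T? (adj G u v) ×-dec
                 all? (λ w → T? (adj G u w) →-dec (¬? (w ∈? S) →-dec (w ≟ v))))
... | yes (u , v , u∈S , v∉S , u~v , only)
    with zeroForcing-or-obstructed G (S ∪ ⁅ v ⁆)
           (rec (p⊆p∪q ⁅ v ⁆ , v , q⊆p∪q S ⁅ v ⁆ (x∈⁅x⁆ v) , v∉S))
...   | inj₁ fs      = inj₁ (force u∈S v∉S u~v only ◅ fs)
...   | inj₂ (F , o) = inj₂ (F , record
  { nonempty = nonempty o
  ; disjoint = λ x∈F x∈S → disjoint o x∈F (p⊆p∪q ⁅ v ⁆ x∈S)
  ; fort     = fort o })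
zeroForcing-or-obstructed {n} G S (acc rec) | no stuck with any? (λ v → ¬? (v ∈? S))
... | no  allBlue = inj₁ (subst (Star (Force G) S)
  (⊆-antisym ⊆⊤ (λ {x} _ → decidable-stable (x ∈? S) (λ x∉S → allBlue (x , x∉S)))) ε)
... | yes (x , x∉S) = inj₂ (∁ S , record
  { nonempty = x , x∉p⇒x∈∁p x∉S
  ; disjoint = x∈∁p⇒x∉p
  ; fort     = another })
  where
  another : ∀ {u v} → u ∉ ∁ S → v ∈ ∁ S → G ⊢ u ~ v → ∃[ w ] (w ∈ ∁ S × G ⊢ u ~ w × w ≢ v)
  another {u} {v} u∉ v∈ u~v with any? (λ w → w ∈? ∁ S ×-dec T? (adj G u w) ×-dec ¬? (w ≟ v))
  ... | yes found = found
  ... | no  none  = contradiction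
    (u , v , x∉∁p⇒x∈p u∉ , x∈∁p⇒x∉p v∈ , u~v ,
      λ w u~w w∉S → decidable-stable (w ≟ v) (λ w≢v → none (w , x∉p⇒x∈∁p w∉S , u~w , w≢v)))
    stuck

-- Opaque, as unfolding the decision procedure makes type checking unfeasible.
opaque

  fails : Graph n → Subset n → Bool
  fails G S = not (does (zeroForcing? G S))

  fails≡not-zeroForcing : ∀ (G : Graph n) S → fails G S ≡ not (does (zeroForcing? G S))
  fails≡not-zeroForcing G S = refl

  fails⇒obstructed : ∀ (G : Graph n) S → T (fails G S) → ∃ (Obstructs G S)
  fails⇒obstructed G S t with zeroForcing? G S
  ... | no ¬zf with zeroForcing-or-obstructed G S (⊃-wellFounded S)
  ...   | inj₁ zf = contradiction zf ¬zf
  ...   | inj₂ o  = o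

  obstructed⇒fails : ∀ (G : Graph n) S {F} → Obstructs G S F → T (fails G S)
  obstructed⇒fails G S o with zeroForcing? G S
  ... | yes zf = contradiction zf (obstructs⇒¬zeroForcing o)
  ... | no  _  = _

-- Sums over all subsets

sumOver : ∀ n → (Subset n → ℕ) → ℕ
sumOver zero    f = f []
sumOver (suc n) f = sumOver n (f ∘ (inside ∷_)) + sumOver n (f ∘ (outside ∷_))

sumOver-mono : ∀ n {f g : Subset n → ℕ} → (∀ S → f S ≤ g S) → sumOver n f ≤ sumOver n g
sumOver-mono zero    f≤g = f≤g []
sumOver-mono (suc n) f≤g =
  +-mono-≤ (sumOver-mono n (f≤g ∘ (inside ∷_))) (sumOver-mono n (f≤g ∘ (outside ∷_)))

sumOver-cong : ∀ n {f g : Subset n → ℕ} → (∀ S → f S ≡ g S) → sumOver n f ≡ sumOver n g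
sumOver-cong n f≡g =
  ≤-antisym (sumOver-mono n (≤-reflexive ∘ f≡g)) (sumOver-mono n (≤-reflexive ∘ sym ∘ f≡g))

sumOver-+ : ∀ n (f g : Subset n → ℕ) →
            sumOver n (λ S → f S + g S) ≡ sumOver n f + sumOver n g
sumOver-+ zero    f g = refl
sumOver-+ (suc n) f g = trans
  (cong₂ _+_ (sumOver-+ n (f ∘ (inside ∷_)) (g ∘ (inside ∷_)))
             (sumOver-+ n (f ∘ (outside ∷_)) (g ∘ (outside ∷_))))
  (interchange +-commutativeSemigroup (sumOver n (f ∘ (inside ∷_))) _ _ _)

sumOver-0 : ∀ n → sumOver n (λ _ → 0) ≡ 0
sumOver-0 zero    = refl
sumOver-0 (suc n) = cong₂ _+_ (sumOver-0 n) (sumOver-0 n)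

-- The recursion of `sumOver` branches on the first vertex only; vertex deletion needs a branching
-- on an arbitrary `v`.
sumOver-insertAt : ∀ n (v : Fin (suc n)) (f : Subset (suc n) → ℕ) →
  sumOver (suc n) f ≡ sumOver n (λ S → f (insertAt S v inside) + f (insertAt S v outside))
sumOver-insertAt n       zero    f = sym (sumOver-+ n _ _)
sumOver-insertAt (suc n) (suc v) f =
  cong₂ _+_ (sumOver-insertAt n v (f ∘ (inside ∷_))) (sumOver-insertAt n v (f ∘ (outside ∷_)))

⟦_⟧ : Bool → ℕ
⟦ true  ⟧ = 1
⟦ false ⟧ = 0

⟦⟧-mono : ∀ b c → (T b → T c) → ⟦ b ⟧ ≤ ⟦ c ⟧
⟦⟧-mono false _     _   = z≤n
⟦⟧-mono true  true  _   = s≤s z≤n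
⟦⟧-mono true  false b⇒c = contradiction (b⇒c _) λ ()

∧-monoˡ : ∀ b c d → (T b → T c) → T (b ∧ d) → T (c ∧ d)
∧-monoˡ true true d _   t = t
∧-monoˡ true false d b⇒c t = b⇒c _

length-filter : ∀ n {P : Pred (Subset n) 0ℓ} (P? : Decidable P) →
                length (filter P? (subsets n)) ≡ sumOver n (λ S → ⟦ does (P? S) ⟧)
length-filter zero    P? with does (P? [])
... | true  = refl
... | false = refl
length-filter (suc n) P? = trans
  (cong length (filter-++ P? (map (inside ∷_) (subsets n)) (map (outside ∷_) (subsets n))))
  (trans (length-++ (filter P? (map (inside ∷_) (subsets n))))
    (cong₂ _+_ (trans (length-filter-map (inside ∷_) (subsets n)) (length-filter n (P? ∘ (inside ∷_))))
               (trans (length-filter-map (outside ∷_) (subsets n)) (length-filter n (P? ∘ (outside ∷_))))))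
  where
  length-filter-map : ∀ (g : Subset n → Subset (suc n)) xs →
                      length (filter P? (map g xs)) ≡ length (filter (P? ∘ g) xs)
  length-filter-map g []       = refl
  length-filter-map g (x ∷ xs) with does (P? (g x))
  ... | true  = cong suc (length-filter-map g xs)
  ... | false = length-filter-map g xs

-- Counting failing sets

-- Sizes are selected by a predicate, so that setting a blue vertex aside turns `q` into `q ∘ suc`
-- without subtraction.
#failing : Graph n → (ℕ → Bool) → ℕ
#failing {n} G q = sumOver n (λ S → ⟦ fails G S ∧ q ∣ S ∣ ⟧)

-- Every set of size `k` either forces or fails, so the total is a binomial coefficient, the same
-- for `G` and for the path.
z+#failing : ∀ (G : Graph n) k →
             z G k + #failing G (_≡ᵇ k) ≡ sumOver n (λ S → ⟦ ∣ S ∣ ≡ᵇ k ⟧)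
z+#failing {n} G k = trans
  (cong (_+ #failing G (_≡ᵇ k)) (length-filter n (λ S → zeroForcing? G S ×-dec (∣ S ∣ ℕ.≟ k))))
  (trans (sym (sumOver-+ n _ _)) (sumOver-cong n λ S →
    partition (does (zeroForcing? G S)) (fails G S) (∣ S ∣ ≡ᵇ k) (fails≡not-zeroForcing G S)))
  where
  partition : ∀ b b′ c → b′ ≡ not b → ⟦ b ∧ c ⟧ + ⟦ b′ ∧ c ⟧ ≡ ⟦ c ⟧
  partition true  _ c refl = +-identityʳ ⟦ c ⟧
  partition false _ c refl = refl

#failing-oversized : ∀ (G : Graph n) {k} → n < k → #failing G (_≡ᵇ k) ≡ 0
#failing-oversized {n} G {k} n<k = trans (sumOver-cong n none) (sumOver-0 n)
  where
  none : ∀ S → ⟦ fails G S ∧ (∣ S ∣ ≡ᵇ k) ⟧ ≡ 0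
  none S with fails G S | ∣ S ∣ ≡ᵇ k in eq
  ... | false | _     = refl
  ... | true  | false = refl
  ... | true  | true  = contradiction (subst (_≤ n) (≡ᵇ⇒≡ ∣ S ∣ k (subst T (sym eq) _)) (∣p∣≤n S)) (<⇒≱ n<k)

FailsMoreThanPath : Graph n → Set
FailsMoreThanPath {n} G = ∀ k → #failing (path n) (_≡ᵇ k) ≤ #failing G (_≡ᵇ k)

failsMore⇒extremal : ∀ {G : Graph n} → FailsMoreThanPath G → PathExtremal G
failsMore⇒extremal {n} {G} more k _ = +-cancelʳ-≤ (#failing (path n) (_≡ᵇ k)) (z G k) (z (path n) k)
  (≤-trans (+-monoʳ-≤ (z G k) (more k))
           (≤-reflexive (trans (z+#failing G k) (sym (z+#failing (path n) k)))))

extremal⇒failsMore : ∀ {G : Graph n} → PathExtremal G → FailsMoreThanPath G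
extremal⇒failsMore {n} {G} ext k with k ≤? n
... | no  k≰n = ≤-trans (≤-reflexive (#failing-oversized (path n) (≰⇒> k≰n))) z≤n
... | yes k≤n = +-cancelˡ-≤ (z (path n) k) (#failing (path n) (_≡ᵇ k)) (#failing G (_≡ᵇ k))
  (≤-trans (≤-reflexive (trans (z+#failing (path n) k) (sym (z+#failing G k))))
           (+-monoˡ-≤ (#failing G (_≡ᵇ k)) (ext k k≤n)))

-- For `zero` the size predicate is constantly false, so the path side vanishes.
failsMore-suc : ∀ {G : Graph n} → FailsMoreThanPath G → ∀ k →
                #failing (path n) ((_≡ᵇ k) ∘ suc) ≤ #failing G ((_≡ᵇ k) ∘ suc)
failsMore-suc more (suc k) = more k
failsMore-suc {n} more zero = sumOver-mono n λ S → ⟦⟧-mono _ _ (λ t → contradiction t (¬T∧false (fails (path n) S)))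
  where
  ¬T∧false : ∀ b → ¬ T (b ∧ false)
  ¬T∧false true ()

-- The path

-- No two consecutive vertices are blue, where a vertex of colour b is put in
-- front of S and a blue one behind it.
sparse : Bool → Subset n → Bool
sparse b     []          = not b
sparse true  (true  ∷ S) = false
sparse true  (false ∷ S) = sparse false S
sparse false (s     ∷ S) = sparse s S

#sparse : Bool → ∀ n → (ℕ → Bool) → ℕ
#sparse b n q = sumOver n (λ S → ⟦ sparse b S ∧ q ∣ S ∣ ⟧)

#sized : ∀ n → (ℕ → Bool) → ℕ
#sized n q = sumOver n (λ S → ⟦ q ∣ S ∣ ⟧)

-- After a blue vertex only a white one may follow, so the half of the sum with a blue first vertex
-- is zero.
#sparse-true-suc : ∀ n q → #sparse true (suc n) q ≡ #sparse false n q
#sparse-true-suc n q = cong (_+ #sparse false n q) (sumOver-0 n)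

-- The first vertex is white. A blue second vertex leaves `n` vertices behind a blue one; a white
-- second vertex merges with the first.
#sparse-recurrence : ∀ n q →
  #sparse true (suc (suc n)) q ≡ #sparse true n (q ∘ suc) + #sparse true (suc n) q
#sparse-recurrence n q = trans (#sparse-true-suc (suc n) q)
  (cong (#sparse true n (q ∘ suc) +_) (sym (#sparse-true-suc n q)))

#sparse≤#sized : ∀ b n q → #sparse b n q ≤ #sized n q
#sparse≤#sized b n q = sumOver-mono n λ S → ⟦⟧-mono _ _ (drop (sparse b S))
  where
  drop : ∀ b {c} → T (b ∧ c) → T c
  drop true t = t

-- A blue first vertex makes the next one white, which accounts for the lost vertex; a white first
-- vertex leaves the same problem on one vertex fewer. A single last vertex must be white because of
-- the blue one behind it.
#sparse-false≤ : ∀ n q → #sparse false (suc n) q ≤ #sized n q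
#sparse-false≤ zero    q = ≤-refl
#sparse-false≤ (suc n) q = +-mono-≤
  (≤-trans (≤-reflexive (#sparse-true-suc n (q ∘ suc))) (#sparse≤#sized false n (q ∘ suc)))
  (#sparse-false≤ n q)

-- Positions beyond the last vertex count as blue.
colour : Subset n → ℕ → Bool
colour []      k       = true
colour (s ∷ S) zero    = s
colour (s ∷ S) (suc k) = colour S k

colour-lookup : ∀ (S : Subset n) i → colour S (toℕ i) ≡ lookup S i
colour-lookup (s ∷ S) zero    = refl
colour-lookup (s ∷ S) (suc i) = colour-lookup S i

colour-white : ∀ (S : Subset n) k → ¬ T (colour S k) → ∃[ i ] (toℕ i ≡ k × i ∉ S)
colour-white []          k       ¬t = contradiction _ ¬t
colour-white (true  ∷ S) zero    ¬t = contradiction _ ¬t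
colour-white (false ∷ S) zero    ¬t = zero , refl , λ ()
colour-white (s     ∷ S) (suc k) ¬t with colour-white S k ¬t
... | i , refl , i∉S = suc i , refl , λ { (there i∈S) → i∉S i∈S }

colour⇒∈ : ∀ (S : Subset n) i → T (colour S (toℕ i)) → i ∈ S
colour⇒∈ S i t with lookup S i in eq | colour-lookup S i
... | true  | _  = lookup⇒[]= i S eq
... | false | e  = contradiction (subst T e t) λ ()

∈⇒colour : ∀ (S : Subset n) i → i ∈ S → T (colour S (toℕ i))
∈⇒colour S i i∈S = subst T (sym (trans (colour-lookup S i) ([]=⇒lookup i∈S))) _

-- Positions in `b ∷ S` run from 0, the vertex in front, to `suc n`, the blue one behind; with `k`
-- up to `n` both boundary pairs are covered.
sparse⇒no-consecutive : ∀ b (S : Subset n) k → k ≤ n → T (sparse b S) →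
                        T (colour (b ∷ S) k) → ¬ T (colour (b ∷ S) (suc k))
sparse⇒no-consecutive false []          zero    _ sp ()
sparse⇒no-consecutive true  (false ∷ S) zero    _ sp t t′ = t′
sparse⇒no-consecutive true  (false ∷ S) (suc k) (s≤s k≤n) sp t t′ = sparse⇒no-consecutive false S k k≤n sp t t′
sparse⇒no-consecutive false (s ∷ S)     zero    _ sp t t′ = t
sparse⇒no-consecutive false (s ∷ S)     (suc k) (s≤s k≤n) sp t t′ = sparse⇒no-consecutive s S k k≤n sp t t′

sparse-or-consecutive : ∀ b (S : Subset n) → T (sparse b S) ⊎
                        ∃[ k ] (k ≤ n × T (colour (b ∷ S) k) × T (colour (b ∷ S) (suc k)))
sparse-or-consecutive false []          = inj₁ _
sparse-or-consecutive true  []          = inj₂ (0 , z≤n , _ , _)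
sparse-or-consecutive true  (true  ∷ S) = inj₂ (0 , z≤n , _ , _)
sparse-or-consecutive true  (false ∷ S) with sparse-or-consecutive false S
... | inj₁ sp              = inj₁ sp
... | inj₂ (k , k≤n , t,t) = inj₂ (suc k , s≤s k≤n , t,t)
sparse-or-consecutive false (s ∷ S) with sparse-or-consecutive s S
... | inj₁ sp              = inj₁ sp
... | inj₂ (k , k≤n , t,t) = inj₂ (suc k , s≤s k≤n , t,t)

path-up : ∀ {u v : Fin n} → suc (toℕ u) ≡ toℕ v → path n ⊢ u ~ v
path-up {u = u} {v} e = Equivalence.from (T-∨ {suc (toℕ u) ≡ᵇ toℕ v}) (inj₁ (≡⇒≡ᵇ _ _ e))

path-adjacent : ∀ {u v : Fin n} → path n ⊢ u ~ v → suc (toℕ u) ≡ toℕ v ⊎ suc (toℕ v) ≡ toℕ u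
path-adjacent {u = u} {v} e with Equivalence.to (T-∨ {suc (toℕ u) ≡ᵇ toℕ v}) e
... | inj₁ t = inj₁ (≡ᵇ⇒≡ _ _ t)
... | inj₂ t = inj₂ (≡ᵇ⇒≡ _ _ t)

white-above : ∀ (S : Subset n) {u} → T (sparse true S) → u ∈ S → ∃[ v ] (toℕ v ≡ suc (toℕ u) × v ∉ S)
white-above S {u} sp u∈S = colour-white S (suc (toℕ u))
  (sparse⇒no-consecutive true S (suc (toℕ u)) (toℕ<n u) sp (∈⇒colour S u u∈S))

white-below : ∀ (S : Subset n) {u} → T (sparse true S) → u ∈ S → ∃[ v ] (suc (toℕ v) ≡ toℕ u × v ∉ S)
white-below S {u} sp u∈S with toℕ u | toℕ<n u | ∈⇒colour S u u∈S
... | zero  | _   | t = contradiction t (sparse⇒no-consecutive true S 0 z≤n sp _)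
... | suc k | k<n | t with colour-white S k (λ t′ → sparse⇒no-consecutive true S (suc k) (<⇒≤ k<n) sp t′ t)
...   | v , e , v∉S = v , cong suc e , v∉S

-- Both neighbours of a blue vertex exist and are white, and one of them differs from `v`. The
-- patterns left out are absurd, as `sparse true` rejects the empty vector and a blue first vertex.
sparse⇒obstructed : ∀ (S : Subset n) → T (sparse true S) → Obstructs (path n) S (∁ S)
sparse⇒obstructed {n} S@(false ∷ _) sp = record
  { nonempty = zero , x∉p⇒x∈∁p {p = S} (λ ())
  ; disjoint = x∈∁p⇒x∉p
  ; fort     = other }
  where
  other : ∀ {u v} → u ∉ ∁ S → v ∈ ∁ S → path n ⊢ u ~ v →
          ∃[ w ] (w ∈ ∁ S × path n ⊢ u ~ w × w ≢ v)
  other {u} {v} u∉ _ _ with white-above S {u} sp (x∉∁p⇒x∈p u∉) | white-below S {u} sp (x∉∁p⇒x∈p u∉)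
  ... | a , ea , a∉S | b , eb , b∉S with a ≟ v
  ...   | no  a≢v  = a , x∉p⇒x∈∁p a∉S , path-up (sym ea) , a≢v
  ...   | yes refl = b , x∉p⇒x∈∁p b∉S , ~-sym (path n) {b} {u} (path-up eb) ,
    λ b≡a → <⇒≢ (≤-trans (≤-reflexive eb) (n≤1+n _)) (trans (cong toℕ b≡a) ea)

-- Two consecutive positions outside the fort spread, since a vertex outside `F` cannot have just
-- one neighbour in `F`. Going down to the front and then up again leaves every position outside
-- `F`, which is nonempty.
obstructed⇒sparse : ∀ (S F : Subset n) → Obstructs (path n) S F → T (sparse true S)
obstructed⇒sparse {n} S F o with sparse-or-consecutive true S
... | inj₁ sp               = sp
... | inj₂ (k , k≤n , t , t′) = contradiction (_ , refl , proj₂ (nonempty o))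
  (proj₂ (up (toℕ (proj₁ (nonempty o))) (<⇒≤ (toℕ<n _)) (down k k≤n (blue k t , blue (suc k) t′))))
  where
  -- Positions are those of `true ∷ S`: vertex `i` has position `suc (toℕ i)`, and 0 and `suc n` are
  -- never white.
  White : ℕ → Set
  White k = ∃[ i ] (suc (toℕ i) ≡ k × i ∈ F)

  blue : ∀ k → T (colour (true ∷ S) k) → ¬ White k
  blue _ t (i , refl , i∈F) = disjoint o i∈F (colour⇒∈ S i t)

  only-neighbour : ∀ {u v} → u ∉ F → v ∈ F → path n ⊢ u ~ v →
                   ¬ (∀ w → path n ⊢ u ~ w → w ∈ F → w ≡ v)
  only-neighbour u∉F v∈F u~v only with fort o u∉F v∈F u~v
  ... | w , w∈F , u~w , w≢v = w≢v (only w u~w w∈F)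

  step-up : ∀ {k} → k < n → ¬ White k → ¬ White (suc k) → ¬ White (suc (suc k))
  step-up {k} k<n ¬k ¬k+1 (v , e , v∈F) = only-neighbour {u} (λ u∈F → ¬k+1 (u , cong suc eu , u∈F)) v∈F
    (path-up (trans (cong suc eu) (sym (suc-injective e)))) only
    where
    u = fromℕ< k<n
    eu : toℕ u ≡ k
    eu = toℕ-fromℕ< k<n
    only : ∀ w → path n ⊢ u ~ w → w ∈ F → w ≡ v
    only w u~w w∈F with path-adjacent {u = u} {w} u~w
    ... | inj₁ e′ = toℕ-injective (trans (sym e′) (trans (cong suc eu) (sym (suc-injective e))))
    ... | inj₂ e′ = contradiction (w , trans e′ eu , w∈F) ¬k

  step-down : ∀ {k} → k < n → ¬ White (suc k) → ¬ White (suc (suc k)) → ¬ White k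
  step-down {k} k<n ¬k+1 ¬k+2 (v , e , v∈F) = only-neighbour {u} (λ u∈F → ¬k+1 (u , cong suc eu , u∈F)) v∈F
    (~-sym (path n) {v} {u} (path-up (trans e (sym eu)))) only
    where
    u = fromℕ< k<n
    eu : toℕ u ≡ k
    eu = toℕ-fromℕ< k<n
    only : ∀ w → path n ⊢ u ~ w → w ∈ F → w ≡ v
    only w u~w w∈F with path-adjacent {u = u} {w} u~w
    ... | inj₁ e′ = contradiction (w , cong suc (trans (sym e′) (cong suc eu)) , w∈F) ¬k+2
    ... | inj₂ e′ = toℕ-injective (suc-injective (trans e′ (trans eu (sym e))))

  Good : ℕ → Set
  Good k = ¬ White k × ¬ White (suc k)

  down : ∀ k → k ≤ n → Good k → Good 0
  down zero    _   g         = g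
  down (suc k) k<n (¬1 , ¬2) = down k (<⇒≤ k<n) (step-down k<n ¬1 ¬2 , ¬1)

  up : ∀ k → k ≤ n → Good 0 → Good k
  up zero    _   g = g
  up (suc k) k<n g with up k (<⇒≤ k<n) g
  ... | ¬0 , ¬1 = ¬1 , step-up k<n ¬0 ¬1

#failing-path : ∀ n q → #failing (path n) q ≡ #sparse true n q
#failing-path n q = ≤-antisym
  (sumOver-mono n λ S → ⟦⟧-mono _ _ (∧-monoˡ (fails (path n) S) (sparse true S) _ λ t →
    let F , o = fails⇒obstructed (path n) S t in obstructed⇒sparse S F o))
  (sumOver-mono n λ S → ⟦⟧-mono _ _ (∧-monoˡ (sparse true S) (fails (path n) S) _ λ t →
    obstructed⇒fails (path n) S (sparse⇒obstructed S t)))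

-- Vertex deletion

delete : Fin (suc n) → Graph (suc n) → Graph n
delete v G = record
  { adj      = λ i j → adj G (punchIn v i) (punchIn v j)
  ; ~-sym    = ~-sym G
  ; ~-irrefl = ~-irrefl G }

data Around (v : Fin (suc n)) : Fin (suc n) → Set where
  here  : Around v v
  there : ∀ i → Around v (punchIn v i)

around : ∀ (v x : Fin (suc n)) → Around v x
around v x with v ≟ x
... | yes refl = here
... | no  v≢x  = subst (Around v) (punchIn-punchOut v≢x) (there (punchOut v≢x))

v∈insertAt : ∀ (S : Subset n) v → v ∈ insertAt S v inside
v∈insertAt S v = lookup⇒[]= v _ (insertAt-lookup S v inside)

v∉insertAt : ∀ (S : Subset n) v → v ∉ insertAt S v outside
v∉insertAt S v v∈ with trans (sym ([]=⇒lookup v∈)) (insertAt-lookup S v outside)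
... | ()

module _ {S : Subset n} (v : Fin (suc n)) {b : Bool} {i : Fin n} where

  ∈-insertAt⁺ : i ∈ S → punchIn v i ∈ insertAt S v b
  ∈-insertAt⁺ i∈S = lookup⇒[]= _ _ (trans (insertAt-punchIn S v b i) ([]=⇒lookup i∈S))

  ∈-insertAt⁻ : punchIn v i ∈ insertAt S v b → i ∈ S
  ∈-insertAt⁻ i∈ = lookup⇒[]= i S (trans (sym (insertAt-punchIn S v b i)) ([]=⇒lookup i∈))

∣insertAt-inside∣ : ∀ (S : Subset n) v → ∣ insertAt S v inside ∣ ≡ suc ∣ S ∣
∣insertAt-inside∣ S           zero    = refl
∣insertAt-inside∣ (true  ∷ S) (suc v) = cong suc (∣insertAt-inside∣ S v)
∣insertAt-inside∣ (false ∷ S) (suc v) = ∣insertAt-inside∣ S v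

∣insertAt-outside∣ : ∀ (S : Subset n) v → ∣ insertAt S v outside ∣ ≡ ∣ S ∣
∣insertAt-outside∣ S           zero    = refl
∣insertAt-outside∣ (true  ∷ S) (suc v) = cong suc (∣insertAt-outside∣ S v)
∣insertAt-outside∣ (false ∷ S) (suc v) = ∣insertAt-outside∣ S v

obstructs-shrink : ∀ {G : Graph (suc n)} {S F} v → Obstructs G (insertAt S v inside) F →
                   v ∉ F × Obstructs G (insertAt S v outside) F
obstructs-shrink {S = S} {F} v o = (λ v∈F → disjoint o v∈F (v∈insertAt S v)) , record
  { nonempty = nonempty o ; disjoint = disj ; fort = fort o }
  where
  disj : ∀ {x} → x ∈ F → x ∉ insertAt S v outside
  disj {x} x∈F x∈ with around v x
  ... | here    = v∉insertAt S v x∈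
  ... | there i = disjoint o x∈F (∈-insertAt⁺ v (∈-insertAt⁻ v x∈))

-- The other vertices keep their neighbours in the fort, so only `v` has to be checked. As `v` stays
-- outside, its colour `s` is free.
lift-outside : ∀ (G : Graph (suc n)) v s {S F} → Obstructs (delete v G) S F →
  (∀ {i} → i ∈ F → G ⊢ v ~ punchIn v i → ∃[ j ] (j ∈ F × G ⊢ v ~ punchIn v j × j ≢ i)) →
  Obstructs G (insertAt S v s) (insertAt F v outside)
lift-outside G v s {S} {F} o at-v = record
  { nonempty = punchIn v (proj₁ (nonempty o)) , ∈-insertAt⁺ v (proj₂ (nonempty o))
  ; disjoint = disj
  ; fort     = other }
  where
  F′ = insertAt F v outside
  disj : ∀ {x} → x ∈ F′ → x ∉ insertAt S v s
  disj {x} x∈F x∈S with around v x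
  ... | here    = v∉insertAt F v x∈F
  ... | there i = disjoint o (∈-insertAt⁻ v x∈F) (∈-insertAt⁻ v x∈S)

  other : ∀ {x y} → x ∉ F′ → y ∈ F′ → G ⊢ x ~ y → ∃[ w ] (w ∈ F′ × G ⊢ x ~ w × w ≢ y)
  other {x} {y} x∉ y∈ x~y with around v y
  ... | here    = contradiction y∈ (v∉insertAt F v)
  ... | there i with around v x
  ...   | here    with at-v (∈-insertAt⁻ v y∈) x~y
  ...     | j , j∈F , v~j , j≢i =
    punchIn v j , ∈-insertAt⁺ v j∈F , v~j , λ e → j≢i (punchIn-injective v j i e)
  other {x} {y} x∉ y∈ x~y | there i | there k
    with fort o (λ k∈F → x∉ (∈-insertAt⁺ v k∈F)) (∈-insertAt⁻ v y∈) x~y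
  ... | j , j∈F , k~j , j≢i =
    punchIn v j , ∈-insertAt⁺ v j∈F , k~j , λ e → j≢i (punchIn-injective v j i e)

-- Inside the fort `v` is exempt itself, but an outside vertex adjacent to `v` now needs a neighbour
-- in `F` besides `v`.
lift-inside : ∀ (G : Graph (suc n)) v {S F} → Obstructs (delete v G) S F →
  (∀ {i} → i ∉ F → G ⊢ punchIn v i ~ v → ∃[ j ] (j ∈ F × G ⊢ punchIn v i ~ punchIn v j)) →
  Obstructs G (insertAt S v outside) (insertAt F v inside)
lift-inside G v {S} {F} o to-v = record
  { nonempty = v , v∈insertAt F v
  ; disjoint = disj
  ; fort     = other }
  where
  F′ = insertAt F v inside
  disj : ∀ {x} → x ∈ F′ → x ∉ insertAt S v outside
  disj {x} x∈F x∈S with around v x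
  ... | here    = v∉insertAt S v x∈S
  ... | there i = disjoint o (∈-insertAt⁻ v x∈F) (∈-insertAt⁻ v x∈S)

  other : ∀ {x y} → x ∉ F′ → y ∈ F′ → G ⊢ x ~ y → ∃[ w ] (w ∈ F′ × G ⊢ x ~ w × w ≢ y)
  other {x} {y} x∉ y∈ x~y with around v x
  ... | here    = contradiction (v∈insertAt F v) x∉
  ... | there k with around v y
  ...   | here with to-v (λ k∈F → x∉ (∈-insertAt⁺ v k∈F)) x~y
  ...     | j , j∈F , k~j = punchIn v j , ∈-insertAt⁺ v j∈F , k~j , punchInᵢ≢i v j
  other {x} {y} x∉ y∈ x~y | there k | there i
    with fort o (λ k∈F → x∉ (∈-insertAt⁺ v k∈F)) (∈-insertAt⁻ v y∈) x~y
  ... | j , j∈F , k~j , j≢i =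
    punchIn v j , ∈-insertAt⁺ v j∈F , k~j , λ e → j≢i (punchIn-injective v j i e)

-- Isolated vertices, twins and pendant vertices

Isolated : Graph n → Fin n → Set
Isolated G v = ∀ w → ¬ G ⊢ w ~ v

Twins : Graph n → Fin n → Fin n → Set
Twins G u v = u ≢ v × (∀ w → w ≢ u → w ≢ v → (G ⊢ w ~ u) ⇔ (G ⊢ w ~ v))

PendantAt : Graph n → Fin n → Fin n → Set
PendantAt G u v = G ⊢ u ~ v × (∀ w → G ⊢ v ~ w → w ≡ u)

-- `⁅ v ⁆` is a fort, so any set on the other `n` vertices fails. The path has no more failing sets,
-- as its first vertex must be white.
isolated-failsMore : ∀ {G : Graph n} {v} → Isolated G v → FailsMoreThanPath G
isolated-failsMore {suc n} {G} {v} isolated k =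
  ≤-trans (≤-reflexive (trans (#failing-path (suc n) q) (#sparse-true-suc n q)))
  (≤-trans (#sparse≤#sized false n q)
  (≤-trans (sumOver-mono n pointwise)
  (≤-reflexive (sym (sumOver-insertAt n v f)))))
  where
  q = _≡ᵇ k
  f : Subset (suc n) → ℕ
  f S = ⟦ fails G S ∧ q ∣ S ∣ ⟧

  obstructs : ∀ S → Obstructs G (insertAt S v outside) ⁅ v ⁆
  obstructs S = record
    { nonempty = v , x∈⁅x⁆ v
    ; disjoint = λ x∈ x∈S → v∉insertAt S v (subst (_∈ insertAt S v outside) (x∈⁅y⁆⇒x≡y v x∈) x∈S)
    ; fort     = λ {u} {w} _ w∈ u~w →
        contradiction (subst (G ⊢ u ~_) (x∈⁅y⁆⇒x≡y v w∈) u~w) (isolated u) }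

  pointwise : ∀ S → ⟦ q ∣ S ∣ ⟧ ≤ f (insertAt S v inside) + f (insertAt S v outside)
  pointwise S = ≤-trans
    (⟦⟧-mono _ _ λ t → ∧-monoˡ true (fails G (insertAt S v outside)) _
      (λ _ → obstructed⇒fails G _ (obstructs S)) (subst (T ∘ q) (sym (∣insertAt-outside∣ S v)) t))
    (m≤n+m _ (f (insertAt S v inside)))

sumOver-insertAt² : ∀ n v u (f : Subset (suc (suc n)) → ℕ) →
  let g = λ S b c → f (insertAt (insertAt S u c) v b) in
  sumOver (suc (suc n)) f ≡
  sumOver n (λ S → (g S inside inside + g S outside inside) + (g S inside outside + g S outside outside))
sumOver-insertAt² n v u f = trans (sumOver-insertAt (suc n) v f) (sumOver-insertAt n u (λ S → f (insertAt S v inside) + f (insertAt S v outside)))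

-- The pair `u`, `v` is a fort, so any set on the other `n` vertices fails; `#sparse-false≤` bounds
-- the path by the number of these sets.
twins-failsMore : ∀ {G : Graph n} {u v} → Twins G u v → FailsMoreThanPath G
twins-failsMore {suc zero} {u = zero} {zero} (u≢v , _) = contradiction refl u≢v
twins-failsMore {suc (suc n)} {G} {u} {v} (u≢v , twins) k with around v u
... | here     = contradiction refl u≢v
... | there u′ =
  ≤-trans (≤-reflexive (trans (#failing-path (suc (suc n)) q) (#sparse-true-suc (suc n) q)))
  (≤-trans (#sparse-false≤ n q)
  (≤-trans (sumOver-mono n pointwise)
  (≤-reflexive (sym (sumOver-insertAt² n v u′ f)))))
  where
  q = _≡ᵇ k
  f : Subset (suc (suc n)) → ℕ
  f S = ⟦ fails G S ∧ q ∣ S ∣ ⟧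

  without : Subset n → Subset (suc (suc n))
  without S = insertAt (insertAt S u′ outside) v outside

  F : Subset (suc (suc n))
  F = ⁅ u ⁆ ∪ ⁅ v ⁆

  F-cases : ∀ {x} → x ∈ F → x ≡ u ⊎ x ≡ v
  F-cases x∈ with x∈p∪q⁻ ⁅ u ⁆ ⁅ v ⁆ x∈
  ... | inj₁ x∈u = inj₁ (x∈⁅y⁆⇒x≡y u x∈u)
  ... | inj₂ x∈v = inj₂ (x∈⁅y⁆⇒x≡y v x∈v)

  u∈F : u ∈ F
  u∈F = p⊆p∪q ⁅ v ⁆ (x∈⁅x⁆ u)

  v∈F : v ∈ F
  v∈F = q⊆p∪q ⁅ u ⁆ ⁅ v ⁆ (x∈⁅x⁆ v)

  disj : ∀ S {x} → x ∈ F → x ∉ without S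
  disj S x∈F x∈S with F-cases x∈F
  ... | inj₁ refl = v∉insertAt S u′ (∈-insertAt⁻ v x∈S)
  ... | inj₂ refl = v∉insertAt _ v x∈S

  other : ∀ {x y} → x ∉ F → y ∈ F → G ⊢ x ~ y → ∃[ w ] (w ∈ F × G ⊢ x ~ w × w ≢ y)
  other {x} x∉F y∈F x~y with F-cases y∈F
                           | twins x (λ { refl → x∉F u∈F }) (λ { refl → x∉F v∈F })
  ... | inj₁ refl | tw = v , v∈F , Equivalence.to tw x~y , λ v≡u → u≢v (sym v≡u)
  ... | inj₂ refl | tw = u , u∈F , Equivalence.from tw x~y , u≢v

  size-without : ∀ S → ∣ without S ∣ ≡ ∣ S ∣
  size-without S = trans (∣insertAt-outside∣ _ v) (∣insertAt-outside∣ S u′)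

  pointwise : ∀ S → ⟦ q ∣ S ∣ ⟧ ≤
    (f (insertAt (insertAt S u′ inside) v inside) + f (insertAt (insertAt S u′ inside) v outside)) +
    (f (insertAt (insertAt S u′ outside) v inside) + f (without S))
  pointwise S = ≤-trans
    (⟦⟧-mono _ _ λ t → ∧-monoˡ true (fails G (without S)) _
      (λ _ → obstructed⇒fails G (without S) record
        { nonempty = u , u∈F ; disjoint = disj S ; fort = other })
      (subst (T ∘ q) (sym (size-without S)) t))
    (≤-trans (m≤n+m _ (f (insertAt (insertAt S u′ outside) v inside)))
             (m≤n+m _ (f (insertAt (insertAt S u′ inside) v inside) + f (insertAt (insertAt S u′ inside) v outside))))

-- The neighbour `u` is taken as a vertex of `delete v G`, so that the removal of both is an
-- iterated deletion.
module Pendant {n : ℕ} (G : Graph (suc (suc n))) (v : Fin (suc (suc n))) (u : Fin (suc n))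
               (u~v : G ⊢ punchIn v u ~ v) (only : ∀ w → G ⊢ v ~ w → w ≡ punchIn v u) where

  G-v : Graph (suc n)
  G-v = delete v G

  G-vu : Graph n
  G-vu = delete u G-v

  neighbour≡u : ∀ {i} → G ⊢ v ~ punchIn v i → i ≡ u
  neighbour≡u {i} v~i = punchIn-injective v i u (only _ v~i)

  -- If `u` lies in the fort, `v` can join it, as the only neighbour of `v` is inside; otherwise `v`
  -- has no neighbour in the fort, which can stay as it is.
  fails-outside : ∀ S → T (fails G-v S) → T (fails G (insertAt S v outside))
  fails-outside S t with fails⇒obstructed G-v S t
  ... | F , o with u ∈? F
  ...   | yes u∈F = obstructed⇒fails G _ (lift-inside G v o λ i∉F i~v →
    contradiction (subst (_∈ F) (sym (neighbour≡u (~-sym G i~v))) u∈F) i∉F)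
  ...   | no  u∉F = obstructed⇒fails G _ (lift-outside G v outside o λ i∈F v~i →
    contradiction (subst (_∈ F) (neighbour≡u v~i) i∈F) u∉F)

  lift-away-from-u : ∀ {S F} → u ∉ F → Obstructs G-v S F → T (fails G (insertAt S v inside))
  lift-away-from-u {F = F} u∉F o = obstructed⇒fails G _ (lift-outside G v inside o λ i∈F v~i →
    contradiction (subst (_∈ F) (neighbour≡u v~i) i∈F) u∉F)

  -- A blue `u` lies outside the fort, so `v` has no neighbour in it: the blue colour can move from
  -- `u` to `v`, keeping both the fort and the size.
  fails-inside : ∀ S → T (fails G-v (insertAt S u inside)) →
                 T (fails G (insertAt (insertAt S u outside) v inside))
  fails-inside S t with fails⇒obstructed G-v _ t
  ... | F , o with obstructs-shrink u o
  ...   | u∉F , o′ = lift-away-from-u u∉F o′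

  -- A fort F of G - v - u avoids u and v.  If u has exactly one neighbour in F,
  -- then F ∪ {v} is a fort of G; otherwise F itself is one.
  fails-one-inside : ∀ S → T (fails G-vu S) →
                     T (fails G (insertAt (insertAt S u outside) v inside)) ⊎
                     T (fails G (insertAt (insertAt S u inside) v outside))
  fails-one-inside S t with fails⇒obstructed G-vu S t
  ... | F , o with any? (λ i → i ∈? F ×-dec T? (adj G-v u (punchIn u i)) ×-dec
                     ¬? (any? λ j → j ∈? F ×-dec T? (adj G-v u (punchIn u j)) ×-dec ¬? (j ≟ i)))
  -- No neighbour of `u` in `F` is the only one, so `F` is a fort of `G-v` too, and `v` may be blue.
  ...   | no none = inj₁ (lift-away-from-u (v∉insertAt F u) (lift-outside G-v u outside o λ {i} i∈F u~i →
    decidable-stable (any? λ j → j ∈? F ×-dec T? (adj G-v u (punchIn u j)) ×-dec ¬? (j ≟ i))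
      λ unique → none (i , i∈F , u~i , unique)))
  ...   | yes (i , i∈F , u~i , _) = inj₂ (obstructed⇒fails G _ record
    { nonempty = v , v∈insertAt _ v
    ; disjoint = disj
    ; fort     = other })
    where
    F′ = insertAt (insertAt F u outside) v inside

    disj : ∀ {x} → x ∈ F′ → x ∉ insertAt (insertAt S u inside) v outside
    disj {x} x∈F x∈S with around v x
    ... | here    = v∉insertAt _ v x∈S
    ... | there y with around u y
    ...   | here    = v∉insertAt F u (∈-insertAt⁻ v x∈F)
    ...   | there j = disjoint o (∈-insertAt⁻ u (∈-insertAt⁻ v x∈F)) (∈-insertAt⁻ u (∈-insertAt⁻ v x∈S))

    inF : ∀ {j} → j ∈ F → punchIn v (punchIn u j) ∈ F′
    inF j∈F = ∈-insertAt⁺ v (∈-insertAt⁺ u j∈F)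

    other : ∀ {x y} → x ∉ F′ → y ∈ F′ → G ⊢ x ~ y → ∃[ w ] (w ∈ F′ × G ⊢ x ~ w × w ≢ y)
    other {x} {y} x∉ y∈ x~y with around v x
    ... | here     = contradiction (v∈insertAt _ v) x∉
    ... | there x′ with around v y | around u x′
    -- At `u`, the neighbour `i` is the second one for `v`, and below `v` is the second one for any
    -- other.
    ...   | here     | here    = _ , inF i∈F , u~i , punchInᵢ≢i v _
    ...   | here     | there k = contradiction (neighbour≡u (~-sym G x~y)) (punchInᵢ≢i u k)
    ...   | there y′ | here    = v , v∈insertAt _ v , u~v , λ e → punchInᵢ≢i v _ (sym e)
    ...   | there y′ | there k with around u y′
    ...     | here    = contradiction (∈-insertAt⁻ v y∈) (v∉insertAt F u)
    ...     | there j with fort o (λ k∈F → x∉ (inF k∈F)) (∈-insertAt⁻ u (∈-insertAt⁻ v y∈)) x~y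
    ...       | l , l∈F , k~l , l≢j = _ , inF l∈F , k~l ,
      λ e → l≢j (punchIn-injective u l j (punchIn-injective v _ _ e))

  -- Both sides are split by the trace `S` off `u` and `v`. The two sets with exactly one of `u`,
  -- `v` blue pay for `S` in `G-vu` and for `S` with `u` in `G-v`.
  #failing-superadditive : ∀ q → #failing G-vu (q ∘ suc) + #failing G-v q ≤ #failing G q
  #failing-superadditive q =
    ≤-trans (≤-reflexive (cong (#failing G-vu (q ∘ suc) +_) (sumOver-insertAt n u f-v)))
    (≤-trans (≤-reflexive (sym (sumOver-+ n f-vu _)))
    (≤-trans (sumOver-mono n pointwise)
    (≤-reflexive (sym (sumOver-insertAt² n v u f)))))
    where
    f : Subset (suc (suc n)) → ℕ
    f S = ⟦ fails G S ∧ q ∣ S ∣ ⟧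

    f-v : Subset (suc n) → ℕ
    f-v S = ⟦ fails G-v S ∧ q ∣ S ∣ ⟧

    f-vu : Subset n → ℕ
    f-vu S = ⟦ fails G-vu S ∧ q (suc ∣ S ∣) ⟧

    -- In `k₁₀` the first index is the colour of `v` and the second that of `u`; the index of `g` is
    -- the colour of `u`.
    bound : ∀ (g₀ g₁ h k₀₀ k₁₀ k₀₁ k₁₁ q₀ q₁ q₂ : Bool) →
            (T g₀ → T k₀₀) → (T g₁ → T k₁₀) → (T g₁ → T k₀₁) → (T h → T k₁₀ ⊎ T k₀₁) →
            ⟦ h ∧ q₁ ⟧ + (⟦ g₁ ∧ q₁ ⟧ + ⟦ g₀ ∧ q₀ ⟧) ≤
            (⟦ k₁₁ ∧ q₂ ⟧ + ⟦ k₀₁ ∧ q₁ ⟧) + (⟦ k₁₀ ∧ q₁ ⟧ + ⟦ k₀₀ ∧ q₀ ⟧)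
    bound g₀ g₁ h k₀₀ k₁₀ k₀₁ k₁₁ q₀ q₁ q₂ g₀⇒ g₁⇒ g₁⇒′ h⇒ =
      ≤-trans (≤-reflexive (sym (+-assoc ⟦ h ∧ q₁ ⟧ _ _)))
      (≤-trans (+-mono-≤ (two q₁ h g₁ k₀₁ k₁₀ g₁⇒′ g₁⇒ h⇒) (⟦⟧-mono _ _ (∧-monoˡ g₀ k₀₀ q₀ g₀⇒)))
      (≤-trans (≤-reflexive (+-assoc ⟦ k₀₁ ∧ q₁ ⟧ _ _))
      (+-monoˡ-≤ _ (m≤n+m ⟦ k₀₁ ∧ q₁ ⟧ ⟦ k₁₁ ∧ q₂ ⟧))))
      where
      -- With `g`, both `k` and `l` hold and pay for `g` and `h` together; without it, one of them
      -- pays for `h`.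
      two : ∀ q h g k l → (T g → T k) → (T g → T l) → (T h → T l ⊎ T k) →
            ⟦ h ∧ q ⟧ + ⟦ g ∧ q ⟧ ≤ ⟦ k ∧ q ⟧ + ⟦ l ∧ q ⟧
      two q h     true  false l     g⇒k _   _  = contradiction (g⇒k _) λ ()
      two q h     true  true  false _   g⇒l _  = contradiction (g⇒l _) λ ()
      two q h     true  true  true  _   _   _  = +-monoˡ-≤ ⟦ q ⟧ (⟦⟧-mono (h ∧ q) q (∧-monoˡ h true q _))
      two q false false k     l     _   _   _  = z≤n
      two q true  false true  l     _   _   _  = ≤-trans (≤-reflexive (+-identityʳ _)) (m≤m+n ⟦ q ⟧ _)
      two q true  false false true  _   _   _  = ≤-reflexive (+-identityʳ _)
      two q true  false false false _   _   h⇒ with h⇒ _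
      ... | inj₁ ()
      ... | inj₂ ()

    pointwise : ∀ S → f-vu S + (f-v (insertAt S u inside) + f-v (insertAt S u outside)) ≤
      (f (insertAt (insertAt S u inside) v inside) + f (insertAt (insertAt S u inside) v outside)) +
      (f (insertAt (insertAt S u outside) v inside) + f (insertAt (insertAt S u outside) v outside))
    pointwise S
      rewrite ∣insertAt-outside∣ (insertAt S u inside) v
            | ∣insertAt-outside∣ (insertAt S u outside) v
            | ∣insertAt-inside∣ (insertAt S u inside) v
            | ∣insertAt-inside∣ (insertAt S u outside) v
            | ∣insertAt-inside∣ S u
            | ∣insertAt-outside∣ S u =
      bound (fails G-v (insertAt S u outside)) (fails G-v (insertAt S u inside)) (fails G-vu S)
            (fails G (insertAt (insertAt S u outside) v outside))
            (fails G (insertAt (insertAt S u outside) v inside))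
            (fails G (insertAt (insertAt S u inside) v outside))
            (fails G (insertAt (insertAt S u inside) v inside))
            _ _ _
            (fails-outside _) (fails-inside S) (fails-outside _) (fails-one-inside S)

  pendant-failsMore : FailsMoreThanPath G-v → FailsMoreThanPath G-vu → FailsMoreThanPath G
  pendant-failsMore more-v more-vu k =
    ≤-trans (≤-reflexive (trans (#failing-path (suc (suc n)) q) (#sparse-recurrence n q)))
    (≤-trans (+-mono-≤ (≤-trans (≤-reflexive (sym (#failing-path n (q ∘ suc)))) (failsMore-suc {G = G-vu} more-vu k))
                       (≤-trans (≤-reflexive (sym (#failing-path (suc n) q))) (more-v k)))
    (#failing-superadditive q))
    where
    q = _≡ᵇ k

-- Walks in an acyclic graph

module NonBacktracking {n : ℕ} (G : Graph n) where

  next : ∀ {u v} → Walk G u v → Maybe (Fin n)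
  next ε                 = nothing
  next (_◅_ {j = j} _ _) = just j

  -- A local substitute for being a path, equally strong in an acyclic graph: gluing needs a check
  -- at the join only.
  data NB : ∀ {u v} → Walk G u v → Set where
    ε   : ∀ {u} → NB (ε {x = u})
    _◅_ : ∀ {u v x} {e : G ⊢ u ~ v} {w : Walk G v x} → next w ≢ just u → NB w → NB (e ◅ w)

  toNB : ∀ {u v} → Walk G u v → ∃ (NB {u} {v})
  toNB ε = ε , ε
  toNB (_◅_ {i = u} e w) with toNB w
  ... | ε , nb = e ◅ ε , (λ ()) ◅ nb
  ... | _◅_ {j = x} f w′ , away ◅ nb with x ≟ u
  -- The walk leaves `u` and comes straight back, so both steps are dropped.
  ...   | yes refl = w′ , nb
  ...   | no  x≢u  = e ◅ f ◅ w′ , (λ eq → x≢u (just-injective eq)) ◅ away ◅ nb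

  -- The reversal of `w₁` followed by `w₂`, with `w₂` as accumulator, so that accessibility can be
  -- transported edge by edge.
  glue : ∀ {b i j} → Walk G b i → Walk G b j → Walk G i j
  glue ε                           w₂ = w₂
  glue (_◅_ {i = b} {j = c} e w₁) w₂ = glue w₁ (~-sym G {b} {c} e ◅ w₂)

  glue-NB : ∀ {b i j} {w₁ : Walk G b i} {w₂ : Walk G b j} → NB w₁ → NB w₂ →
            (∀ {c} → next w₁ ≡ just c → next w₂ ≢ just c) → NB (glue w₁ w₂)
  glue-NB ε              nb₂ diverge = nb₂
  glue-NB (away ◅ nb₁) nb₂ diverge =
    glue-NB nb₁ (diverge refl ◅ nb₂) λ eq eq′ → away (trans eq (sym eq′))

  glue-nonempty : ∀ {b i j} (w₁ : Walk G b i) (w₂ : Walk G b j) →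
                  next w₂ ≢ nothing → next (glue w₁ w₂) ≢ nothing
  glue-nonempty ε        w₂ ne = ne
  glue-nonempty (e ◅ w₁) w₂ ne = glue-nonempty w₁ _ λ ()

  end∈vertices : ∀ {u v} (w : Walk G u v) → v ∈ˡ vertices w
  end∈vertices ε       = here refl
  end∈vertices (_ ◅ w) = there (end∈vertices w)

  prefix : ∀ {u v x} (w : Walk G u v) → IsPath w → x ∈ˡ vertices w →
           Σ (Walk G u x) λ q → IsPath q × (∀ {y} → y ∈ˡ vertices q → y ∈ˡ vertices w) ×
                                (∀ {y} → next q ≡ just y → next w ≡ just y)
  prefix ε       p        (here refl) = ε , [] ∷ [] , (λ y∈ → y∈) , λ ()
  prefix (e ◅ w) p        (here refl) = ε , [] ∷ [] , (λ { (here eq) → here eq }) , λ ()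
  prefix (e ◅ w) (u∉ ∷ p) (there x∈) with prefix w p x∈
  ... | q , pq , q⊆w , _ =
    e ◅ q , All.tabulate (λ y∈q → All.lookup u∉ (q⊆w y∈q)) ∷ pq ,
    (λ { (here eq) → here eq ; (there y∈q) → there (q⊆w y∈q) }) , λ eq → eq

  -- If `u` reappeared on the rest, the part up to it would be empty and `e` a loop, or a single
  -- step and the walk would turn back, or it would close a cycle with `e`.
  NB⇒path : Acyclic G → ∀ {u v} {w : Walk G u v} → NB w → IsPath w
  NB⇒path acyclic ε = [] ∷ []
  NB⇒path acyclic (_◅_ {u} {v} {e = e} {w} away nb) = All.tabulate fresh ∷ p
    where
    p : IsPath w
    p = NB⇒path acyclic nb

    fresh : ∀ {x} → x ∈ˡ vertices w → u ≢ x
    fresh x∈ refl with prefix w p x∈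
    ... | ε          , _  , _ , _     = ~-irrefl G {u} e
    ... | f ◅ ε      , _  , _ , next≡ = away (next≡ refl)
    ... | f ◅ g ◅ q  , pq , _ , _     = acyclic (f ◅ g ◅ q) pq (s≤s (s≤s (nonempty-length q))) e
      where
      nonempty-length : ∀ {u v} (w : Walk G u v) → 1 ≤ length (vertices w)
      nonempty-length ε       = s≤s z≤n
      nonempty-length (_ ◅ _) = s≤s z≤n

  closed-NB : Acyclic G → ∀ {u} (w : Walk G u u) → NB w → next w ≡ nothing
  closed-NB acyclic ε       nb = refl
  closed-NB acyclic (e ◅ w) nb with NB⇒path acyclic nb
  ... | u∉ ∷ _ = contradiction refl (All.lookup u∉ (end∈vertices w))

  -- Were the first steps different, gluing the walks would give a nonempty closed walk without
  -- turning back.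
  next-unique : Acyclic G → ∀ {u v} (w₁ w₂ : Walk G u v) → NB w₁ → NB w₂ → next w₁ ≡ next w₂
  next-unique acyclic ε w₂ _ nb₂ = sym (closed-NB acyclic w₂ nb₂)
  next-unique acyclic w₁@(_ ◅ _) ε nb₁ _ = closed-NB acyclic w₁ nb₁
  next-unique acyclic w₁@(_◅_ {j = c} _ _) w₂@(_◅_ {j = d} _ _) nb₁ nb₂ with c ≟ d
  ... | yes refl = refl
  ... | no  c≢d  = contradiction
    (closed-NB acyclic (glue w₁ w₂) (glue-NB nb₁ nb₂ λ { refl eq → c≢d (sym (just-injective eq)) }))
    (glue-nonempty w₁ w₂ λ ())

  NB-tail : ∀ {u v x} (w : Walk G u v) → NB w → next w ≡ just x → Σ (Walk G x v) λ w′ → NB w′ × next w′ ≢ just u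
  NB-tail (e ◅ w) (away ◅ nb) refl = w , nb , away

unique⇒lookup-injective : ∀ {xs : List (Fin n)} → Unique xs → Injective _≡_ _≡_ (List.lookup xs)
unique⇒lookup-injective (_  ∷ _) {zero}  {zero}  _  = refl
unique⇒lookup-injective (x∉ ∷ _) {zero}  {suc j} eq = contradiction eq (All.lookup x∉ (∈-lookup j))
unique⇒lookup-injective (x∉ ∷ _) {suc i} {zero}  eq = contradiction (sym eq) (All.lookup x∉ (∈-lookup i))
unique⇒lookup-injective (_  ∷ p) {suc i} {suc j} eq = cong suc (unique⇒lookup-injective p eq)

unique⇒length≤ : ∀ {xs : List (Fin n)} → Unique xs → length xs ≤ n
unique⇒length≤ p = injective⇒≤ (unique⇒lookup-injective p)

-- Seeing a graph from a bag

-- The vertices of K are mapped to vertices of the label L: a vertex of the bag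
-- to itself, any other one to the marker that leads to it.
record View (K : Graph m) (L : Graph n) : Set₁ where
  field
    position  : Fin m → Fin n
    Reached   : Fin m → Set
    reached?  : ∀ u → Dec (Reached u)
    adjacent⇒ : ∀ {u v} → position u ≢ position v → K ⊢ u ~ v →
                L ⊢ position u ~ position v × Reached u × Reached v
    adjacent⇐ : ∀ {u v} → position u ≢ position v → L ⊢ position u ~ position v →
                Reached u → Reached v → K ⊢ u ~ v

-- Reducible graphs seen from cliques and stars

data Reducible (K : Graph m) : Set where
  isolated : ∀ {v} → Isolated K v → Reducible K
  twins    : ∀ {u v} → Twins K u v → Reducible K
  pendant  : ∀ {u v} → PendantAt K u v → Reducible K

T⇔⇒≡ : ∀ {a b} → (T a → T b) → (T b → T a) → a ≡ b
T⇔⇒≡ {true}  {true}  _ _ = refl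
T⇔⇒≡ {false} {false} _ _ = refl
T⇔⇒≡ {true}  {false} f _ = contradiction (f _) λ ()
T⇔⇒≡ {false} {true}  _ g = contradiction (g _) λ ()

¬T⇒≡ : ∀ {a b} → ¬ T a → ¬ T b → a ≡ b
¬T⇒≡ ¬a ¬b = T⇔⇒≡ (λ a → contradiction a ¬a) (λ b → contradiction b ¬b)

module _ {K : Graph m} {L : Graph n} (V : View K L) where
  open View V

  Alone : Fin m → Set
  Alone x = ∀ y → position y ≡ position x → y ≡ x

  alone-unreached⇒isolated : ∀ {x} → Alone x → ¬ Reached x → Isolated K x
  alone-unreached⇒isolated {x} alone ¬r w w~x with position w ≟ position x
  ... | yes eq = ~-irrefl K {x} (subst (λ w → K ⊢ w ~ x) (alone w eq) w~x)
  ... | no  pos≢  = ¬r (proj₂ (proj₂ (adjacent⇒ {w} {x} pos≢ w~x)))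

  -- Once all vertices are reached, adjacency in `K` is adjacency of positions; an unreached vertex
  -- is alone, hence isolated.
  injective⇒embeds : Injective _≡_ _≡_ position → IsInducedSubgraph K L ⊎ Reducible K
  injective⇒embeds inj with any? (λ x → ¬? (reached? x))
  ... | yes (x , ¬r) = inj₂ (isolated (alone-unreached⇒isolated {x} (λ y → inj) ¬r))
  ... | no  all      = inj₁ (position , inj , same)
    where
    reached : ∀ x → Reached x
    reached x = decidable-stable (reached? x) λ ¬r → all (x , ¬r)
    same : ∀ u v → adj K u v ≡ adj L (position u) (position v)
    same u v with u ≟ v
    ... | yes refl = ¬T⇒≡ (~-irrefl K {u}) (~-irrefl L {position u})
    ... | no  u≢v  = T⇔⇒≡ (λ e → proj₁ (adjacent⇒ pos≢ e)) (λ e → adjacent⇐ pos≢ e (reached u) (reached v))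
      where
      pos≢ : position u ≢ position v
      pos≢ eq = u≢v (inj eq)

  module _ {x y : Fin m} (x≢y : x ≢ y) (alone-x : Alone x) (alone-y : Alone y) where

    reached-case : (Reached x → Reached y → Reducible K) → Reducible K
    reached-case reduce with reached? x | reached? y
    ... | no ¬rx | _      = isolated (alone-unreached⇒isolated alone-x ¬rx)
    ... | yes _  | no ¬ry = isolated (alone-unreached⇒isolated alone-y ¬ry)
    ... | yes rx | yes ry = reduce rx ry

    -- A third vertex has a position different from those of `x` and `y`, so its adjacency to them
    -- is decided in `L`.
    twins-case : Reached x → Reached y →
      (∀ p → p ≢ position x → p ≢ position y →
        (L ⊢ p ~ position x → L ⊢ p ~ position y) × (L ⊢ p ~ position y → L ⊢ p ~ position x)) → Reducible K
    twins-case rx ry same = twins (x≢y , λ w w≢x w≢y →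
      let px = λ eq → w≢x (alone-x w eq)
          py = λ eq → w≢y (alone-y w eq)
      in mk⇔ (λ e → let l , rw , _ = adjacent⇒ px e in adjacent⇐ py (proj₁ (same _ px py) l) rw ry)
             (λ e → let l , rw , _ = adjacent⇒ py e in adjacent⇐ px (proj₂ (same _ px py) l) rw rx))

    clique-reducible : IsClique L → Reducible K
    clique-reducible clique = reached-case λ rx ry → twins-case rx ry λ p p≢x p≢y →
      (λ _ → clique p _ p≢y) , (λ _ → clique p _ p≢x)

    centre-leaf : ∀ {c} → IsStarWithCentre L c → position x ≡ c → position y ≢ c →
                  Reached x → Reached y → Reducible K
    centre-leaf star refl ≢c rx ry = pendant
      (adjacent⇐ (λ eq → ≢c (sym eq)) (Equivalence.from (star _ _) ((λ eq → ≢c (sym eq)) , inj₁ refl)) rx ry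
      , only)
      where
      only : ∀ w → K ⊢ y ~ w → w ≡ x
      only w y~w with position y ≟ position w
      ... | yes eq = contradiction (subst (K ⊢ y ~_) (alone-y w (sym eq)) y~w) (~-irrefl K {y})
      ... | no pos≢  with Equivalence.to (star _ _) (proj₁ (adjacent⇒ pos≢ y~w))
      ...   | _ , inj₁ eq = contradiction eq ≢c
      ...   | _ , inj₂ eq = alone-x w eq

  -- Two leaves see only the centre and become twins; if one vertex is at the centre, the other is
  -- pendant at it.
  star-reducible : ∀ {x y} → x ≢ y → Alone x → Alone y → IsStar L → Reducible K
  star-reducible {x} {y} x≢y alone-x alone-y (c , star) = reached-case x≢y alone-x alone-y reduce
    where
    to-leaf : ∀ {p q} → q ≢ c → L ⊢ p ~ q → p ≡ c
    to-leaf {p} {q} q≢c e with Equivalence.to (star p q) e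
    ... | _ , inj₁ eq = eq
    ... | _ , inj₂ eq = contradiction eq q≢c

    reduce : Reached x → Reached y → Reducible K
    reduce rx ry with position x ≟ c | position y ≟ c
    ... | yes ex | yes ey = contradiction (alone-y x (trans ex (sym ey))) x≢y
    ... | yes ex | no  ny = centre-leaf x≢y alone-x alone-y star ex ny rx ry
    ... | no  nx | yes ey = centre-leaf (λ eq → x≢y (sym eq)) alone-y alone-x star ey nx ry rx
    ... | no  nx | no  ny = twins-case x≢y alone-x alone-y rx ry λ p p≢x p≢y →
      (λ e → Equivalence.from (star _ _) (p≢y , inj₁ (to-leaf nx e))) ,
      (λ e → Equivalence.from (star _ _) (p≢x , inj₁ (to-leaf ny e)))

-- The bags of a graph-labelled tree as views

module BagViews (D : GraphLabelledTree) where
  open GraphLabelledTree D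
  open NonBacktracking tree

  acyclic : Acyclic tree
  acyclic {u} {v} = proj₂ tree-isTree {u} {v}

  position : ∀ {b i} → Walk tree b i → Fin (size i) → Fin (size b)
  position ε                         y = y
  position (_◅_ {i = b} {j = c} e _) y = marker {b} {c} e

  -- The part of accessibility beyond `b`: what is required besides adjacency to `position w y` in
  -- the label of `b`.
  Reached : ∀ {b i} → Walk tree b i → Fin (size i) → Set
  Reached ε                         y = ⊤
  Reached (_◅_ {i = b} {j = c} e w) y = AccessibleAlong w (marker {c} {b} (~-sym tree {b} {c} e)) y

  accessible? : ∀ {i j} (w : Walk tree i j) x y → Dec (AccessibleAlong w x y)
  accessible? {i} ε                 x y = T? (adj (label i) x y)
  accessible? {i} (_◅_ {j = j} e w) x y =
    T? (adj (label i) x (marker {i} {j} e)) ×-dec accessible? w (marker {j} {i} (~-sym tree {i} {j} e)) y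

  reached? : ∀ {b i} (w : Walk tree b i) y → Dec (Reached w y)
  reached? ε       y = yes _
  reached? (e ◅ w) y = accessible? w _ y

  accessible⇒ : ∀ {b i} (w : Walk tree b i) {x y} → AccessibleAlong w x y →
                label b ⊢ x ~ position w y × Reached w y
  accessible⇒ ε       a = a , _
  accessible⇒ (e ◅ w) a = a

  accessible⇐ : ∀ {b i} (w : Walk tree b i) {x y} → label b ⊢ x ~ position w y → Reached w y →
                AccessibleAlong w x y
  accessible⇐ ε       e _ = e
  accessible⇐ (_ ◅ w) e r = e , r

  -- `marker` depends on the proof of the edge, and reversing an edge twice yields another proof;
  -- proofs of `T` are all equal.
  marker-irrelevant : ∀ {i j} (e f : tree ⊢ i ~ j) → marker {i} {j} e ≡ marker {i} {j} f
  marker-irrelevant {i} {j} e f = cong (marker {i} {j}) (T-irrelevant e f)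

  -- Accessibility along the glued walk is cut at `b`; as labels are symmetric, the part along `w₁`
  -- can be read backwards.
  glue-accessible⇒ : ∀ {b i j} (w₁ : Walk tree b i) (w₂ : Walk tree b j) {x y} →
    AccessibleAlong (glue w₁ w₂) x y →
    label b ⊢ position w₁ x ~ position w₂ y × Reached w₁ x × Reached w₂ y
  glue-accessible⇒ ε w₂ a = let l , r = accessible⇒ w₂ a in l , _ , r
  glue-accessible⇒ (_◅_ {i = b} {j = c} e w₁) w₂ {x} {y} a
    with glue-accessible⇒ w₁ (~-sym tree {b} {c} e ◅ w₂) a
  ... | l , r₁ , a₂ with accessible⇒ w₂ a₂
  ...   | l₂ , r₂ = subst (λ z → label b ⊢ z ~ position w₂ y) (marker-irrelevant {b} {c} _ e) l₂ ,
                    accessible⇐ w₁ (~-sym (label c) l) r₁ , r₂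

  glue-accessible⇐ : ∀ {b i j} (w₁ : Walk tree b i) (w₂ : Walk tree b j) {x y} →
    label b ⊢ position w₁ x ~ position w₂ y → Reached w₁ x → Reached w₂ y →
    AccessibleAlong (glue w₁ w₂) x y
  glue-accessible⇐ ε w₂ l _ r = accessible⇐ w₂ l r
  glue-accessible⇐ (_◅_ {i = b} {j = c} e w₁) w₂ {x} {y} l a₁ r₂ with accessible⇒ w₁ a₁
  ... | l₁ , r₁ = glue-accessible⇐ w₁ (~-sym tree {b} {c} e ◅ w₂) (~-sym (label c) l₁) r₁
    (accessible⇐ w₂ (subst (λ z → label b ⊢ z ~ position w₂ y) (marker-irrelevant {b} {c} e _) l) r₂)

  next⇒marker : ∀ {b i j} (w : Walk tree b i) {x} → next w ≡ just j →
                (e : tree ⊢ b ~ j) → position w x ≡ marker {b} {j} e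
  next⇒marker {b} {j = j} (f ◅ w) refl e = marker-irrelevant {b} {j} f e

  next⇒edge : ∀ {b i j} (w : Walk tree b i) → next w ≡ just j → tree ⊢ b ~ j
  next⇒edge (e ◅ w) refl = e

  marker⇒next : ∀ {b i j} (w : Walk tree b i) {x} (e : tree ⊢ b ~ j) → ¬ IsMarker (i , x) →
                position w x ≡ marker {b} {j} e → next w ≡ just j
  marker⇒next {j = j} ε e ordinary eq = contradiction (j , e , sym eq) ordinary
  marker⇒next {b} {j = j} (_◅_ {j = k} f w) e ordinary eq = cong just (marker-distinct {b} {k} {j} f e eq)

  -- A shared position is an ordinary vertex only if both walks are empty. Otherwise it is a marker,
  -- and distinct markers at a bag tell the edges apart.
  same-position : ∀ {b i j} (w₁ : Walk tree b i) (w₂ : Walk tree b j) {x y} →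
    ¬ IsMarker (i , x) → ¬ IsMarker (j , y) → position w₁ x ≡ position w₂ y →
    _≡_ {A = LabelVertex} (i , x) (j , y) ⊎ ∃[ k ] (next w₁ ≡ just k × next w₂ ≡ just k)
  same-position ε ε _ _ refl = inj₁ refl
  same-position ε w₂@(_◅_ {j = k} e _) ox _ eq = contradiction (k , e , sym eq) ox
  same-position {b} w₁@(_◅_ {j = k} e _) w₂ ox oy eq =
    inj₂ (k , refl , marker⇒next w₂ e oy (sym eq))

  module Vertices {G : Graph n} (R : Represents D G) where
    open Represents R

    bag : Fin n → Fin #bags
    bag u = proj₁ (place u)

    vertex : ∀ u → Fin (size (bag u))
    vertex u = proj₂ (place u)

    ordinary : ∀ u → ¬ IsMarker (place u)
    ordinary u = Equivalence.to (place-ordinary (place u)) (u , refl)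

    route-NB : ∀ b u → ∃ (NB {b} {bag u})
    route-NB b u = toNB (proj₂ (proj₁ tree-isTree) b (bag u))

    route : ∀ b u → Walk tree b (bag u)
    route b u = proj₁ (route-NB b u)

    -- Routes to vertices at different positions leave `b` in different directions, so glued
    -- together they are the tree path to which `accessibility` applies.
    view : ∀ b → View G (label b)
    view b = record
      { position  = λ u → position (route b u) (vertex u)
      ; Reached   = λ u → Reached (route b u) (vertex u)
      ; reached?  = λ u → reached? (route b u) (vertex u)
      ; adjacent⇒ = λ {u} {v} pos≢ e → glue-accessible⇒ (route b u) (route b v)
          (Equivalence.to (accessibility u v _ (path-between pos≢)) e)
      ; adjacent⇐ = λ {u} {v} pos≢ l ru rv → Equivalence.from (accessibility u v _ (path-between pos≢))
          (glue-accessible⇐ (route b u) (route b v) l ru rv)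
      }
      where
      path-between : ∀ {u v} → position (route b u) (vertex u) ≢ position (route b v) (vertex v) →
                     IsPath (glue (route b u) (route b v))
      path-between {u} {v} pos≢ = NB⇒path acyclic
        (glue-NB (proj₂ (route-NB b u)) (proj₂ (route-NB b v)) λ eq₁ eq₂ →
          let e = next⇒edge (route b u) eq₁ in
          pos≢ (trans (next⇒marker (route b u) eq₁ e) (sym (next⇒marker (route b v) eq₂ e))))

    -- The rest of the route from `b` is a route from `c` that does not return to `b`, and first
    -- steps are unique.
    no-turning-back : ∀ {b c u} → next (route b u) ≡ just c → next (route c u) ≢ just b
    no-turning-back {b} {c} {u} eq eq′ with NB-tail (route b u) (proj₂ (route-NB b u)) eq
    ... | w , nb , away = away (trans (next-unique acyclic w (route c u) nb (proj₂ (route-NB c u))) eq′)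

  module Descent {G : Graph n} (R : Represents D G) (p : Fin #bags)
                 (kind : ∀ i → i ≢ p → IsClique (label i) ⊎ IsStar (label i))
                 {K : Graph m} (K⊆G : IsInducedSubgraph K G) where
    open Represents R
    open Vertices R

    f : Fin m → Fin n
    f = proj₁ K⊆G

    viewK : ∀ b → View K (label b)
    viewK b = record
      { position  = View.position (view b) ∘ f
      ; Reached   = View.Reached (view b) ∘ f
      ; reached?  = λ u → View.reached? (view b) (f u)
      ; adjacent⇒ = λ {u} {v} pos≢ e → View.adjacent⇒ (view b) pos≢ (subst T (proj₂ (proj₂ K⊆G) u v) e)
      ; adjacent⇐ = λ {u} {v} pos≢ l ru rv →
          subst T (sym (proj₂ (proj₂ K⊆G) u v)) (View.adjacent⇐ (view b) pos≢ l ru rv)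
      }

    positionK : ∀ b → Fin m → Fin (size b)
    positionK b = View.position (viewK b)

    next-at : ∀ b → Fin m → Maybe (Fin #bags)
    next-at b x = next (route b (f x))

    same-direction : ∀ b {x y} → x ≢ y → positionK b x ≡ positionK b y →
                     ∃[ c ] (next-at b x ≡ just c × next-at b y ≡ just c)
    same-direction b {x} {y} x≢y eq
      with same-position (route b (f x)) (route b (f y)) (ordinary (f x)) (ordinary (f y)) eq
    ... | inj₁ place≡ = contradiction (proj₁ (proj₂ K⊆G) (place-injective place≡)) x≢y
    ... | inj₂ found  = found

    -- Starting from p, walk to a bag c beyond which, seen from p, there are two
    -- vertices x and y of K, until no further step is possible.
    descend : ∀ fuel {c b} (e : tree ⊢ c ~ b) (r : Walk tree b p) →
              NB {c} (e ◅ r) → #bags < suc (length (vertices r)) + fuel →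
              ∀ {x y} → x ≢ y → next-at c x ≢ just b → next-at c y ≢ just b → Reducible K
    -- Without fuel, the path `e ◅ r` would have more vertices than there are bags.
    descend zero e r nb long _ _ _ =
      contradiction (unique⇒length≤ (NB⇒path acyclic nb)) (<⇒≱ (subst (#bags <_) (+-identityʳ _) long))
    descend (suc fuel) {c} {b} e r nb long {x} {y} x≢y x-beyond y-beyond
      with any? (λ x′ → any? λ y′ → ¬? (x′ ≟ y′) ×-dec (positionK c x′ ≟ positionK c y′) ×-dec
                                    ¬? (positionK c x′ ≟ marker {c} {b} e))
    ... | yes (x′ , y′ , x′≢y′ , eq , ≢parent) with same-direction c x′≢y′ eq
    ...   | d , x′→d , y′→d =
      descend fuel {d} {c} (~-sym tree {c} {d} (next⇒edge (route c (f x′)) x′→d)) (e ◅ r)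
        -- The new bag `d` is not the parent `b`, as the shared position is not the marker towards
        -- `b`.
        ((λ { refl → ≢parent (next⇒marker (route c (f x′)) x′→d e) }) ◅ nb)
        (subst (#bags <_) (+-suc _ fuel) long)
        x′≢y′ (no-turning-back x′→d) (no-turning-back y′→d)
    descend (suc fuel) {c} {b} e r nb long {x} {y} x≢y x-beyond y-beyond | no none
      -- The bag `c` is not `p`, since `e ◅ r` is nonempty and never turns back; so its label is a
      -- clique or a star.
      = [ clique-reducible (viewK c) x≢y (alone x-beyond) (alone y-beyond)
        , star-reducible (viewK c) x≢y (alone x-beyond) (alone y-beyond)
        ]′ (kind c λ { refl → contradiction (closed-NB acyclic (e ◅ r) nb) λ () })
      where
      -- A companion of `x` would be a pair excluded by `none`: as `x` lies beyond `c`, its position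
      -- is not the marker towards `b`.
      alone : ∀ {x} → next-at c x ≢ just b → Alone (viewK c) x
      alone {x} beyond y eq = decidable-stable (y ≟ x) λ y≢x →
        none (x , y , (λ x≡y → y≢x (sym x≡y)) , sym eq ,
          λ at → beyond (marker⇒next (route c (f x)) e (ordinary (f x)) at))

    embeds-or-reducible : IsInducedSubgraph K (label p) ⊎ Reducible K
    embeds-or-reducible with any? (λ x → any? λ y → ¬? (x ≟ y) ×-dec (positionK p x ≟ positionK p y))
    ... | no none = injective⇒embeds (viewK p) λ {x} {y} eq →
      decidable-stable (x ≟ y) λ x≢y → none (x , y , x≢y , eq)
    ... | yes (x , y , x≢y , eq) with same-direction p x≢y eq
    ...   | d , x→d , y→d = inj₂
      (descend #bags {d} {p} (~-sym tree {p} {d} (next⇒edge (route p (f x)) x→d)) ε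
        ((λ ()) ◅ ε) (s≤s (n≤1+n _))
        x≢y (no-turning-back x→d) (no-turning-back y→d))

-- Induction over induced subgraphs

IsInducedSubgraph-trans : ∀ {l} {K : Graph l} {L : Graph m} {G : Graph n} →
  IsInducedSubgraph K L → IsInducedSubgraph L G → IsInducedSubgraph K G
IsInducedSubgraph-trans (f , f-inj , f-adj) (g , g-inj , g-adj) =
  g ∘ f , (λ eq → f-inj (g-inj eq)) , λ u v → trans (f-adj u v) (g-adj (f u) (f v))

delete-induced : ∀ (G : Graph (suc n)) v → IsInducedSubgraph (delete v G) G
delete-induced G v = punchIn v , (λ {i} {j} → punchIn-injective v i j) , λ _ _ → refl

≅⇒induced : ∀ {G : Graph m} {H : Graph n} → G ≅ H → IsInducedSubgraph G H
≅⇒induced (φ , φ-adj) = Inverse.to φ , Injection.injective (↔⇒↣ φ) , φ-adj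

reducible-failsMore : ∀ {K : Graph m} → Reducible K →
  (∀ {l} → l < m → ∀ (L : Graph l) → IsInducedSubgraph L K → FailsMoreThanPath L) →
  FailsMoreThanPath K
reducible-failsMore {K = K} (isolated {v} iso)   rec = isolated-failsMore {G = K} {v} iso
reducible-failsMore {K = K} (twins {u} {v} tw)   rec = twins-failsMore {G = K} {u} {v} tw
reducible-failsMore {suc zero} {K} (pendant {zero} {zero} (e , _)) rec = contradiction e (~-irrefl K {zero})
reducible-failsMore {suc (suc n)} {K} (pendant {u} {v} (u~v , only)) rec with around v u
... | here     = contradiction u~v (~-irrefl K {v})
... | there u′ = Pendant.pendant-failsMore K v u′ u~v only
  (rec ≤-refl (delete v K) (delete-induced K v))
  (rec (n≤1+n _) (delete u′ (delete v K))
    (IsInducedSubgraph-trans {K = delete u′ (delete v K)} {L = delete v K} {G = K} (delete-induced (delete v K) u′) (delete-induced K v)))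

-- Induced subgraphs of `G` are closed under deletion, so strong induction on the number of vertices
-- supplies the smaller graphs that a pendant vertex calls for.
failsMore-hereditarily : ∀ {h n} {H : Graph h} {G : Graph n} →
  (∀ {m} (K : Graph m) → IsInducedSubgraph K H → FailsMoreThanPath K) →
  (∀ {m} (K : Graph m) → IsInducedSubgraph K G → IsInducedSubgraph K H ⊎ Reducible K) →
  ∀ m (K : Graph m) → IsInducedSubgraph K G → FailsMoreThanPath K
failsMore-hereditarily {H = H} {G} base reduce =
  <-rec (λ m → ∀ (K : Graph m) → IsInducedSubgraph K G → FailsMoreThanPath K) λ _ rec K K⊆G →
    [ base K
    , (λ red → reducible-failsMore {K = K} red λ l<m L L⊆K →
        rec l<m L (IsInducedSubgraph-trans {K = L} {L = K} {G = G} L⊆K K⊆G))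
    ]′ (reduce K K⊆G)

theorem2 : ∀ {h : ℕ} (H : Graph h) → SplitPrime H →
    (∀ {m : ℕ} (K : Graph m) → IsInducedSubgraph K H → PathExtremal K) →
    ∀ {n : ℕ} (G : Graph n) → 𝒞 H G → PathExtremal G
theorem2 H _ extremal {n} G c = failsMore⇒extremal {G = G} (failsMore-hereditarily {H = H} {G = G}
  (λ K K⊆H → extremal⇒failsMore {G = K} (extremal K K⊆H))
  (λ K K⊆G → map₁
    (λ K⊆p → IsInducedSubgraph-trans {K = K} {L = label prime-bag} {G = H} K⊆p
      (≅⇒induced {G = label prime-bag} {H = H} prime-bag-≅))
    (BagViews.Descent.embeds-or-reducible decomposition {G = G} (proj₁ canonical) prime-bag kind {K = K} K⊆G))
  n G ((λ u → u) , (λ eq → eq) , λ _ _ → refl))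
  where
  open 𝒞 c
  kind : ∀ i → i ≢ prime-bag → IsClique (label i) ⊎ IsStar (label i)
  kind i i≢p with Reduced.bag-kind (proj₂ canonical) i
  ... | inj₁ (_ , clique)      = inj₁ clique
  ... | inj₂ (inj₁ (_ , star)) = inj₂ star
  ... | inj₂ (inj₂ prime)      = contradiction (prime-bag-unique i prime) i≢p
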